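{- For any $q>0$ there exists some $n_0>0$ such that $\chi_\mu(Q_n)>q$ for all integers $n\geq n_0$. On the other hand, $\chi_\mu(Q_n)=O(\log\log n)$ as $n\to\infty$, i.e., there exist constants $C>0$ and $n_1$ such that $\chi_\mu(Q_n)\leq C\log\log n$ for all integers $n\geq n_1$.
   Context: For a positive integer $n$, write $[n]=\{1,\dots,n\}$. The $n$-dimensional hypercube $Q_n$ is the graph on the vertex set $2^{[n]}$ (all subsets of $[n]$), where $A,B\in 2^{[n]}$ are adjacent if and only if $|A\Delta B|=1$, with $A\Delta B=(A\setminus B)\cup(B\setminus A)$. Let $G$ be a simple graph and $M\subseteq V(G)$. Two vertices $u,v\in V(G)$ are $M$-visible if there exists a shortest $u,v$-path in $G$ that contains no vertices from $M\setminus\{u,v\}$. The set $M$ is a mutual-visibility set if any two vertices $u,v\in M$ are $M$-visible. The chromatic mutual-visibility number $\chi_\mu(G)$ is the smallest number of colors in a vertex-coloring of $G$ (not required to be proper) such that each color class is a mutual-visibility set in $G$; equivalently, the smallest integer $k$ such that $V(G)$ can be partitioned into $k$ mutual-visibility sets. -}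

module Defs where

open import Data.Fin.Base using (Fin)
open import Data.Fin.Subset using (Subset; ∣_∣; _─_; _∪_; inside; outside)
open import Data.Fin.Subset.Properties using (∪-comm)
open import Data.List.Base using (List; []; _∷_)
open import Data.List.Relation.Unary.All using (All)
open import Data.List.Relation.Unary.Unique.Propositional using (Unique)
open import Data.Nat.Base using (ℕ; suc; _≤_)
open import Data.Nat.Logarithm using (⌊log₂_⌋)
open import Data.Product.Base using (_×_; ∃-syntax; Σ-syntax)
open import Data.Vec.Base using ([]; _∷_)
open import Level using (0ℓ)
open import Relation.Binary.Construct.Closure.ReflexiveTransitive using (Star; ε; _◅_)
open import Relation.Binary.Core using (Rel)
open import Relation.Binary.Definitions using (Symmetric)
open import Relation.Binary.PropositionalEquality using (_≡_; refl; sym; trans; cong)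
open import Relation.Nullary.Negation using (¬_)
open import Relation.Unary using (Pred; _∈_; _∉_; _∖_; ｛_｝) renaming (_∪_ to _∪ᵖ_)

record SimpleGraph : Set₁ where
  infix 4 _~_
  field
    Vertex   : Set
    _~_      : Rel Vertex 0ℓ
    ~-sym    : Symmetric _~_
    ~-irrefl : ∀ {v} → ¬ (v ~ v)

module _ (G : SimpleGraph) where
  open SimpleGraph G

  Walk : Rel Vertex 0ℓ
  Walk = Star _~_

  vertices : ∀ {u v} → Walk u v → List Vertex
  vertices {u} ε       = u ∷ []
  vertices {u} (_ ◅ w) = u ∷ vertices w

  length : ∀ {u v} → Walk u v → ℕ
  length ε       = 0
  length (_ ◅ w) = suc (length w)

  IsPath : ∀ {u v} → Walk u v → Set
  IsPath w = Unique (vertices w)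

  IsShortestPath : ∀ {u v} → Walk u v → Set
  IsShortestPath {u} {v} p =
    IsPath p × (∀ (p′ : Walk u v) → IsPath p′ → length p ≤ length p′)

  Visible : Pred Vertex 0ℓ → Rel Vertex 0ℓ
  Visible M u v = ∃[ p ] IsShortestPath {u} {v} p ×
                         All (_∉ (M ∖ (｛ u ｝ ∪ᵖ ｛ v ｝))) (vertices p)

  IsMutualVisibilitySet : Pred Vertex 0ℓ → Set
  IsMutualVisibilitySet M = ∀ u v → u ∈ M → v ∈ M → Visible M u v

  -- Colors may go unused: an empty class is vacuously a mutual-visibility set,
  -- and this does not affect the least possible number of colors.
  MutualVisibilityColorable : ℕ → Set
  MutualVisibilityColorable k =
    Σ[ c ∈ (Vertex → Fin k) ] ∀ i → IsMutualVisibilitySet (λ v → c v ≡ i)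

  -- χ_μ(G) = k.  Given as a relation, since a least number of colors cannot be
  -- computed for an arbitrary graph; k is unique by antisymmetry of _≤_.
  IsChromaticMutualVisibilityNumber : ℕ → Set
  IsChromaticMutualVisibilityNumber k =
    MutualVisibilityColorable k × (∀ j → MutualVisibilityColorable j → k ≤ j)

infixl 6 _△_

_△_ : ∀ {n} → Subset n → Subset n → Subset n
A △ B = (A ─ B) ∪ (B ─ A)

△-comm : ∀ {n} (A B : Subset n) → A △ B ≡ B △ A
△-comm A B = ∪-comm (A ─ B) (B ─ A)

∣A△A∣≡0 : ∀ {n} (A : Subset n) → ∣ A △ A ∣ ≡ 0
∣A△A∣≡0 []            = refl
∣A△A∣≡0 (inside  ∷ A) = ∣A△A∣≡0 A
∣A△A∣≡0 (outside ∷ A) = ∣A△A∣≡0 A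

-- Fin n plays the role of [n].
Q : ℕ → SimpleGraph
Q n = record
  { Vertex   = Subset n
  ; _~_      = λ A B → ∣ A △ B ∣ ≡ 1
  ; ~-sym    = λ {A} {B} A~B → trans (cong ∣_∣ (△-comm B A)) A~B
  ; ~-irrefl = λ {A} A~A → 0≢1 (trans (sym (∣A△A∣≡0 A)) A~A)
  }
  where
  0≢1 : ¬ (0 ≡ 1)
  0≢1 ()

-- ⌊log₂ ⌊log₂ n⌋⌋ = ⌊log₂ (log₂ n)⌋, and for n ≥ 4 this lies between
-- (log₂ (log₂ n)) / 2 and log₂ (log₂ n).  A bound that is O(⌊log₂ log₂ n⌋) is thus the
-- same as one that is O(log log n), with the logarithm taken to any base.
⌊log₂log₂_⌋ : ℕ → ℕ
⌊log₂log₂ n ⌋ = ⌊log₂ ⌊log₂ n ⌋ ⌋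

{-# OPTIONS --safe #-}

-- Lower bound.  By Ramsey's theorem every colouring of a large cube with q colours is, on the
-- subsets of some set of 2q elements, a function of the size.  Three of the 2q + 1 sizes i < j < k
-- get the same colour, and a shortest path between nested sets of sizes i and k passes through
-- a set of size j.
--
-- Upper bound.  X is coloured by (∣ X ∣ mod t + 1, φ X) with t = O(log log n), where the
-- two-colouring φ is such that for C ⊆ B with ∣ B ∖ C ∣ ≥ 2t both values of φ occur on the sets of
-- size ∣ C ∣ + t between C and B.  For A, B of the same colour and ∣ A ∣ ≤ ∣ B ∣, the elements of
-- A ∖ B are removed while the size alternates between ∣ A ∣ + 1 and ∣ A ∣ + 2; then the path
-- ascends, crossing each level ≡ ∣ A ∣ at a set of the other φ-value.
--
-- To get φ, choose (Gilbert–Varshamov) a parity check matrix with m = O(t 2 ^ (t / 16)) rows of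
-- a code of distance > 2t, and let φ be a function of the syndrome.  The t-subsets that split
-- t pairs of B ∖ C have 2 ^ t distinct syndromes, which are determined by one vector and 2t columns.
-- There are only 2 ^ (m (2t + 1)) such families of syndromes, so a two-colouring of the syndromes
-- exists for which none is monochromatic.
module Submission where

open import Defs
open import Data.Bool.Base using (Bool; true; false; not; _xor_)
import Data.Bool.Properties as Bool
open import Data.Fin.Base as Fin using (Fin; zero; suc; toℕ; fromℕ<; combine)
import Data.Fin.Properties as Fin
open import Data.Fin.Subset using (Subset; ∣_∣; _─_)
open import Data.Fin.Subset.Properties using (anySubset?; ∣p∣≤n)
open import Data.List.Base as List using (List; []; _∷_)
open import Data.List.Membership.Propositional using () renaming (_∈_ to _∈ˡ_)
import Data.List.Membership.Propositional.Properties as ∈ˡ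
import Data.List.Properties as List
open import Data.List.Relation.Unary.All as All using (All; []; _∷_)
import Data.List.Relation.Unary.All.Properties as All
open import Data.List.Relation.Unary.AllPairs using ([]; _∷_)
open import Data.List.Relation.Unary.Any using (here; there)
open import Data.List.Relation.Unary.Unique.Propositional using (Unique)
import Data.List.Relation.Unary.Unique.Propositional.Properties as Unique
open import Data.List.Relation.Unary.Unique.DecPropositional using (unique?)
open import Data.Maybe.Base using (Maybe; just; nothing)
open import Data.Nat.Base
open import Data.Nat.DivMod
open import Data.Nat.Divisibility using (_∣_; ∣⇒≤; ∣m+n∣m⇒∣n; n∣m*n)
open import Data.Nat.ListAction using (sum)
open import Data.Nat.ListAction.Properties using (sum-++)
open import Data.Nat.Logarithm using (⌊log₂_⌋; ⌊log₂⌋-mono-≤; ⌊log₂[2^n]⌋≡n)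
open import Data.Nat.Properties
open import Data.Nat.Tactic.RingSolver using (solve-∀)
open import Data.Product.Base using (_×_; _,_; proj₁; proj₂; ∃; ∃-syntax; Σ-syntax)
open import Data.Sum.Base using (_⊎_; inj₁; inj₂)
open import Data.Vec.Base as Vec using (Vec; []; _∷_; lookup; replicate; zipWith; _[_]≔_)
import Data.Vec.Properties as Vec
open import Function.Base using (_∘_)
open import Level using (0ℓ)
open import Relation.Binary.Construct.Closure.ReflexiveTransitive using (ε; _◅_; _◅◅_)
open import Relation.Binary.PropositionalEquality
open import Relation.Nullary using (¬_; Dec; yes; no; contradiction)
open import Relation.Nullary.Decidable as Dec using (_×-dec_; _⊎-dec_; _→-dec_; ¬?)
open import Relation.Unary using (Pred; Decidable)

private variable
  m n k : ℕ

-- Distance and cardinality in the cube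

dist : Subset n → Subset n → ℕ
dist A B = ∣ A △ B ∣

dist-sym : (A B : Subset n) → dist A B ≡ dist B A
dist-sym A B = cong ∣_∣ (△-comm A B)

dist≡0⇒≡ : (A B : Subset n) → dist A B ≡ 0 → A ≡ B
dist≡0⇒≡ []          []          _ = refl
dist≡0⇒≡ (false ∷ A) (false ∷ B) p = cong (false ∷_) (dist≡0⇒≡ A B p)
dist≡0⇒≡ (true  ∷ A) (true  ∷ B) p = cong (true ∷_) (dist≡0⇒≡ A B p)
dist≡0⇒≡ (false ∷ A) (true  ∷ B) ()
dist≡0⇒≡ (true  ∷ A) (false ∷ B) ()

dist-triangle : (A B C : Subset n) → dist A C ≤ dist A B + dist B C
dist-triangle []          []          []          = z≤n
dist-triangle (false ∷ A) (false ∷ B) (false ∷ C) = dist-triangle A B C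
dist-triangle (true  ∷ A) (true  ∷ B) (true  ∷ C) = dist-triangle A B C
dist-triangle (false ∷ A) (true  ∷ B) (true  ∷ C) = s≤s (dist-triangle A B C)
dist-triangle (true  ∷ A) (false ∷ B) (false ∷ C) = s≤s (dist-triangle A B C)
dist-triangle (false ∷ A) (false ∷ B) (true  ∷ C) =
  ≤-trans (s≤s (dist-triangle A B C)) (≤-reflexive (sym (+-suc (dist A B) (dist B C))))
dist-triangle (true  ∷ A) (true  ∷ B) (false ∷ C) =
  ≤-trans (s≤s (dist-triangle A B C)) (≤-reflexive (sym (+-suc (dist A B) (dist B C))))
dist-triangle (false ∷ A) (true  ∷ B) (false ∷ C) =
  ≤-trans (m≤n⇒m≤1+n (m≤n⇒m≤1+n (dist-triangle A B C)))
          (s≤s (≤-reflexive (sym (+-suc (dist A B) (dist B C)))))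
dist-triangle (true  ∷ A) (false ∷ B) (true  ∷ C) =
  ≤-trans (m≤n⇒m≤1+n (m≤n⇒m≤1+n (dist-triangle A B C)))
          (s≤s (≤-reflexive (sym (+-suc (dist A B) (dist B C)))))

dist-split : (A B : Subset n) → dist A B ≡ ∣ A ─ B ∣ + ∣ B ─ A ∣
dist-split []          []          = refl
dist-split (false ∷ A) (false ∷ B) = dist-split A B
dist-split (true  ∷ A) (true  ∷ B) = dist-split A B
dist-split (true  ∷ A) (false ∷ B) = cong suc (dist-split A B)
dist-split (false ∷ A) (true  ∷ B) =
  trans (cong suc (dist-split A B)) (sym (+-suc ∣ A ─ B ∣ ∣ B ─ A ∣))

-- Both sides count the union of `A` and `B`.
size-balance : (A B : Subset n) → ∣ A ∣ + ∣ B ─ A ∣ ≡ ∣ B ∣ + ∣ A ─ B ∣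
size-balance []          []          = refl
size-balance (false ∷ A) (false ∷ B) = size-balance A B
size-balance (true  ∷ A) (true  ∷ B) = cong suc (size-balance A B)
size-balance (true  ∷ A) (false ∷ B) =
  trans (cong suc (size-balance A B)) (sym (+-suc ∣ B ∣ ∣ A ─ B ∣))
size-balance (false ∷ A) (true  ∷ B) =
  trans (+-suc ∣ A ∣ ∣ B ─ A ∣) (cong suc (size-balance A B))

∣B∣≤∣A∣+dist : (A B : Subset n) → ∣ B ∣ ≤ ∣ A ∣ + dist A B
∣B∣≤∣A∣+dist A B = begin
  ∣ B ∣                             ≤⟨ m≤m+n ∣ B ∣ ∣ A ─ B ∣ ⟩
  ∣ B ∣ + ∣ A ─ B ∣                 ≡⟨ size-balance A B ⟨
  ∣ A ∣ + ∣ B ─ A ∣                 ≤⟨ +-monoʳ-≤ ∣ A ∣ (m≤n+m ∣ B ─ A ∣ ∣ A ─ B ∣) ⟩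
  ∣ A ∣ + (∣ A ─ B ∣ + ∣ B ─ A ∣)   ≡⟨ cong (∣ A ∣ +_) (dist-split A B) ⟨
  ∣ A ∣ + dist A B                  ∎
  where open ≤-Reasoning

-- Inclusion of sets

infix 4 _≼_

-- Inclusion, in inductive form so that sets between `A` and `B` can be built by recursion on the
-- derivation.
data _≼_ : Subset n → Subset n → Set where
  []   : [] ≼ []
  keep : ∀ b {A B : Subset n} → A ≼ B → b ∷ A ≼ b ∷ B
  add  : {A B : Subset n} → A ≼ B → false ∷ A ≼ true ∷ B

≼⇒∣─∣≡0 : {A B : Subset n} → A ≼ B → ∣ A ─ B ∣ ≡ 0
≼⇒∣─∣≡0 []             = refl
≼⇒∣─∣≡0 (keep true p)  = ≼⇒∣─∣≡0 p
≼⇒∣─∣≡0 (keep false p) = ≼⇒∣─∣≡0 p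
≼⇒∣─∣≡0 (add p)        = ≼⇒∣─∣≡0 p

∣─∣≡0⇒≼ : (A B : Subset n) → ∣ A ─ B ∣ ≡ 0 → A ≼ B
∣─∣≡0⇒≼ []          []          p = []
∣─∣≡0⇒≼ (false ∷ A) (false ∷ B) p = keep false (∣─∣≡0⇒≼ A B p)
∣─∣≡0⇒≼ (true  ∷ A) (true  ∷ B) p = keep true (∣─∣≡0⇒≼ A B p)
∣─∣≡0⇒≼ (false ∷ A) (true  ∷ B) p = add (∣─∣≡0⇒≼ A B p)
∣─∣≡0⇒≼ (true  ∷ A) (false ∷ B) ()

≼⇒∣∣+dist : {A B : Subset n} → A ≼ B → ∣ A ∣ + dist A B ≡ ∣ B ∣
≼⇒∣∣+dist {A = A} {B} p = begin
  ∣ A ∣ + dist A B                 ≡⟨ cong (∣ A ∣ +_) (dist-split A B) ⟩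
  ∣ A ∣ + (∣ A ─ B ∣ + ∣ B ─ A ∣)  ≡⟨ cong (λ z → ∣ A ∣ + (z + ∣ B ─ A ∣)) (≼⇒∣─∣≡0 p) ⟩
  ∣ A ∣ + ∣ B ─ A ∣                ≡⟨ size-balance A B ⟩
  ∣ B ∣ + ∣ A ─ B ∣                ≡⟨ cong (∣ B ∣ +_) (≼⇒∣─∣≡0 p) ⟩
  ∣ B ∣ + 0                        ≡⟨ +-identityʳ ∣ B ∣ ⟩
  ∣ B ∣                            ∎
  where open ≡-Reasoning

≼-via-dist : {A C B : Subset n} → A ≼ C → C ≼ B → A ≼ B → dist A C + dist C B ≡ dist A B
≼-via-dist {A = A} {C} {B} p q r = +-cancelˡ-≡ ∣ A ∣ _ _ (begin
  ∣ A ∣ + (dist A C + dist C B)  ≡⟨ +-assoc ∣ A ∣ _ _ ⟨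
  ∣ A ∣ + dist A C + dist C B    ≡⟨ cong (_+ dist C B) (≼⇒∣∣+dist p) ⟩
  ∣ C ∣ + dist C B               ≡⟨ ≼⇒∣∣+dist q ⟩
  ∣ B ∣                          ≡⟨ ≼⇒∣∣+dist r ⟨
  ∣ A ∣ + dist A B               ∎)
  where open ≡-Reasoning

-- An element of `X` outside `B` would have to be added and later removed. It is counted twice
-- below, and there is no slack for it on a shortest path from `A` up to `B`.
between⇒≼ : {A B : Subset n} (X : Subset n) → A ≼ B →
            dist A X + dist X B ≤ dist A B → X ≼ B
between⇒≼ {A = A} {B} X A≼B le = ∣─∣≡0⇒≼ X B (m+n≡0⇒m≡0 _ (n≤0⇒n≡0 (+-cancelˡ-≤ ∣ B ∣ _ _ (begin
  ∣ B ∣ + (∣ X ─ B ∣ + ∣ X ─ B ∣)          ≡⟨ +-assoc ∣ B ∣ _ _ ⟨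
  ∣ B ∣ + ∣ X ─ B ∣ + ∣ X ─ B ∣            ≡⟨ cong (_+ ∣ X ─ B ∣) (size-balance X B) ⟨
  ∣ X ∣ + ∣ B ─ X ∣ + ∣ X ─ B ∣            ≡⟨ +-assoc ∣ X ∣ _ _ ⟩
  ∣ X ∣ + (∣ B ─ X ∣ + ∣ X ─ B ∣)          ≡⟨ cong (∣ X ∣ +_) (+-comm ∣ B ─ X ∣ ∣ X ─ B ∣) ⟩
  ∣ X ∣ + (∣ X ─ B ∣ + ∣ B ─ X ∣)          ≡⟨ cong (∣ X ∣ +_) (dist-split X B) ⟨
  ∣ X ∣ + dist X B                         ≤⟨ +-monoˡ-≤ (dist X B) (∣B∣≤∣A∣+dist A X) ⟩
  ∣ A ∣ + dist A X + dist X B              ≡⟨ +-assoc ∣ A ∣ _ _ ⟩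
  ∣ A ∣ + (dist A X + dist X B)            ≤⟨ +-monoʳ-≤ ∣ A ∣ le ⟩
  ∣ A ∣ + dist A B                         ≡⟨ ≼⇒∣∣+dist A≼B ⟩
  ∣ B ∣                                    ≡⟨ +-identityʳ ∣ B ∣ ⟨
  ∣ B ∣ + 0                                ∎))))
  where open ≤-Reasoning

-- Shortest paths in the cube

dist≤length : {A B : Subset n} (w : Walk (Q n) A B) → dist A B ≤ length (Q n) w
dist≤length {A = A} ε = ≤-reflexive (∣A△A∣≡0 A)
dist≤length {n} {A} {B} (_◅_ {j = C} A~C w) = begin
  dist A B                  ≤⟨ dist-triangle A C B ⟩
  dist A C + dist C B       ≡⟨ cong (_+ dist C B) A~C ⟩
  suc (dist C B)            ≤⟨ s≤s (dist≤length w) ⟩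
  suc (length (Q n) w)      ∎
  where open ≤-Reasoning

step-towards : ∀ {d} (A B : Subset n) → dist A B ≡ suc d →
               ∃[ C ] dist A C ≡ 1 × dist C B ≡ d
step-towards []          []          ()
step-towards (false ∷ A) (false ∷ B) p with C , q , r ← step-towards A B p = false ∷ C , q , r
step-towards (true  ∷ A) (true  ∷ B) p with C , q , r ← step-towards A B p = true ∷ C , q , r
step-towards (false ∷ A) (true  ∷ B) p = true ∷ A , cong suc (∣A△A∣≡0 A) , suc-injective p
step-towards (true  ∷ A) (false ∷ B) p = false ∷ A , cong suc (∣A△A∣≡0 A) , suc-injective p

walk-of-dist : ∀ d (A B : Subset n) → dist A B ≡ d → ∃[ w ] length (Q n) {A} {B} w ≡ d
walk-of-dist zero    A B p with refl ← dist≡0⇒≡ A B p = ε , refl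
walk-of-dist (suc d) A B p with C , q , r ← step-towards A B p with w , l ← walk-of-dist d C B r =
  q ◅ w , cong suc l

vertices-closer : {A B : Subset n} (w : Walk (Q n) A B) →
                  All (λ X → dist X B ≤ length (Q n) w) (vertices (Q n) w)
vertices-closer {A = A} ε         = ≤-reflexive (∣A△A∣≡0 A) ∷ []
vertices-closer {A = A} (A~C ◅ w) =
  dist≤length {A = A} (A~C ◅ w) ∷ All.map m≤n⇒m≤1+n (vertices-closer w)

-- Every vertex of the tail is at distance at most the length of the tail from `B`, hence nearer
-- than `A`, so `A` does not recur.
length≡dist⇒IsPath : {A B : Subset n} (w : Walk (Q n) A B) →
                     length (Q n) w ≡ dist A B → IsPath (Q n) w
length≡dist⇒IsPath ε _ = [] ∷ []
length≡dist⇒IsPath {n} {A} {B} (_◅_ {j = C} A~C w) l =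
  All.map (λ {X} le A≡X → <⇒≢ (≤-<-trans le (≤-reflexive l)) (cong (λ Y → dist Y B) (sym A≡X)))
          (vertices-closer w)
  ∷ length≡dist⇒IsPath w (≤-antisym (s≤s⁻¹ (begin
      suc (length (Q n) w)   ≡⟨ l ⟩
      dist A B               ≤⟨ dist-triangle A C B ⟩
      dist A C + dist C B    ≡⟨ cong (_+ dist C B) A~C ⟩
      suc (dist C B)         ∎)) (dist≤length w))
  where open ≤-Reasoning

length≡dist⇒IsShortestPath : {A B : Subset n} (w : Walk (Q n) A B) →
                             length (Q n) w ≡ dist A B → IsShortestPath (Q n) w
length≡dist⇒IsShortestPath w l =
  length≡dist⇒IsPath w l , λ w′ _ → ≤-trans (≤-reflexive l) (dist≤length w′)

IsShortestPath⇒length≡dist : {A B : Subset n} (w : Walk (Q n) A B) →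
                             IsShortestPath (Q n) w → length (Q n) w ≡ dist A B
IsShortestPath⇒length≡dist {A = A} {B} w (_ , shortest)
  with w′ , l ← walk-of-dist (dist A B) A B refl =
  ≤-antisym (≤-trans (shortest w′ (length≡dist⇒IsPath w′ l)) (≤-reflexive l)) (dist≤length w)

-- A discrete intermediate value argument: an edge raises the size by at most one. The distance
-- bound records that `X` lies on the walk; for a shortest walk it is the hypothesis of `between⇒≼`.
crosses-level : {A B : Subset n} (w : Walk (Q n) A B) → ∀ k → ∣ A ∣ ≤ k → k ≤ ∣ B ∣ →
                ∃[ X ] ∣ X ∣ ≡ k × X ∈ˡ vertices (Q n) w ×
                       dist A X + dist X B ≤ length (Q n) w
crosses-level {A = A} ε k a≤k k≤b =
  A , ≤-antisym a≤k k≤b , here refl ,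
  ≤-reflexive (cong₂ _+_ (∣A△A∣≡0 A) (∣A△A∣≡0 A))
crosses-level {n} {A} {B} (_◅_ {j = C} A~C w) k a≤k k≤b with ∣ A ∣ ≟ k
... | yes a≡k = A , a≡k , here refl ,
  ≤-trans (≤-reflexive (cong (_+ dist A B) (∣A△A∣≡0 A))) (dist≤length {A = A} (A~C ◅ w))
... | no a≢k = X , x≡k , there X∈w , (begin
    dist A X + dist X B                ≤⟨ +-monoˡ-≤ (dist X B) (dist-triangle A C X) ⟩
    dist A C + dist C X + dist X B     ≡⟨ cong (λ z → z + dist C X + dist X B) A~C ⟩
    suc (dist C X + dist X B)          ≤⟨ s≤s le ⟩
    suc (length (Q n) w)               ∎)
  where
  open ≤-Reasoning
  c≤k : ∣ C ∣ ≤ k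
  c≤k = begin
    ∣ C ∣              ≤⟨ ∣B∣≤∣A∣+dist A C ⟩
    ∣ A ∣ + dist A C   ≡⟨ cong (∣ A ∣ +_) A~C ⟩
    ∣ A ∣ + 1          ≡⟨ +-comm ∣ A ∣ 1 ⟩
    suc ∣ A ∣          ≤⟨ ≤∧≢⇒< a≤k a≢k ⟩
    k                  ∎
  crossing = crosses-level w k c≤k k≤b
  X   = proj₁ crossing
  x≡k = proj₁ (proj₂ crossing)
  X∈w = proj₁ (proj₂ (proj₂ crossing))
  le  = proj₂ (proj₂ (proj₂ crossing))

-- A shortest path cut up at interior vertices. Only these must satisfy `P`, just as visibility
-- exempts the two ends. The tree form makes concatenation and reversal immediate.
data Geodesic {n} (P : Subset n → Set) : Subset n → Subset n → Set where
  stop : ∀ {A} → Geodesic P A A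
  edge : ∀ {A B} → dist A B ≡ 1 → Geodesic P A B
  via  : ∀ {A B} C → P C → dist A C + dist C B ≡ dist A B →
         Geodesic P A C → Geodesic P C B → Geodesic P A B

reverse : {P : Subset n → Set} {A B : Subset n} → Geodesic P A B → Geodesic P B A
reverse stop = stop
reverse (edge {A} {B} p) = edge (trans (dist-sym B A) p)
reverse (via {A} {B} C PC d g h) =
  via C PC (trans (trans (cong₂ _+_ (dist-sym B C) (dist-sym C A)) (+-comm (dist C B) (dist A C)))
                  (trans d (dist-sym A B)))
      (reverse h) (reverse g)

length-◅◅ : {A B C : Subset n} (v : Walk (Q n) A B) (w : Walk (Q n) B C) →
            length (Q n) (v ◅◅ w) ≡ length (Q n) v + length (Q n) w
length-◅◅ ε       w = refl
length-◅◅ (_ ◅ v) w = cong suc (length-◅◅ v w)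

All-◅◅ : {R : Subset n → Set} {A B C : Subset n} (v : Walk (Q n) A B) (w : Walk (Q n) B C) →
         All R (vertices (Q n) v) → All R (vertices (Q n) w) → All R (vertices (Q n) (v ◅◅ w))
All-◅◅ ε       w _        rs = rs
All-◅◅ (_ ◅ v) w (r ∷ qs) rs = r ∷ All-◅◅ v w qs rs

Geodesic⇒Walk : {P : Subset n → Set} {A B : Subset n} → Geodesic P A B →
                ∃[ w ] length (Q n) {A} {B} w ≡ dist A B ×
                       All (λ X → X ≡ A ⊎ X ≡ B ⊎ P X) (vertices (Q n) w)
Geodesic⇒Walk (stop {A}) = ε , sym (∣A△A∣≡0 A) , inj₁ refl ∷ []
Geodesic⇒Walk (edge p) = p ◅ ε , sym p , inj₁ refl ∷ inj₂ (inj₁ refl) ∷ []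
Geodesic⇒Walk {P = P} (via {A} {B} C PC d g h)
  with v , lv , qs ← Geodesic⇒Walk g | w , lw , rs ← Geodesic⇒Walk h =
  v ◅◅ w , trans (length-◅◅ v w) (trans (cong₂ _+_ lv lw) d) ,
  All-◅◅ v w (All.map left qs) (All.map right rs)
  where
  left : ∀ {X} → X ≡ A ⊎ X ≡ C ⊎ P X → X ≡ A ⊎ X ≡ B ⊎ P X
  left (inj₁ x)           = inj₁ x
  left (inj₂ (inj₁ refl)) = inj₂ (inj₂ PC)
  left (inj₂ (inj₂ PX))   = inj₂ (inj₂ PX)
  right : ∀ {X} → X ≡ C ⊎ X ≡ B ⊎ P X → X ≡ A ⊎ X ≡ B ⊎ P X
  right (inj₁ refl) = inj₂ (inj₂ PC)
  right (inj₂ x)    = inj₂ x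

Geodesic⇒Visible : {P : Subset n → Set} {M : Pred (Subset n) 0ℓ} {A B : Subset n} →
                   (∀ X → P X → ¬ M X) → Geodesic P A B → Visible (Q n) M A B
Geodesic⇒Visible {P = P} {M} {A} {B} P⇒¬M g with w , l , rs ← Geodesic⇒Walk g =
  w , length≡dist⇒IsShortestPath w l , All.map avoids rs
  where
  avoids : ∀ {X} → X ≡ A ⊎ X ≡ B ⊎ P X → ¬ (M X × ¬ (A ≡ X ⊎ B ≡ X))
  avoids (inj₁ x)         (_ , X∉)  = X∉ (inj₁ (sym x))
  avoids (inj₂ (inj₁ x))  (_ , X∉)  = X∉ (inj₂ (sym x))
  avoids (inj₂ (inj₂ PX)) (X∈M , _) = P⇒¬M _ PX X∈M

-- Shortest paths that avoid a colour class

record Added (Y B : Subset n) : Set where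
  constructor added
  field
    {Y⁺}   : Subset n
    adj    : dist Y Y⁺ ≡ 1
    size   : ∣ Y⁺ ∣ ≡ suc ∣ Y ∣
    excess : ∣ Y⁺ ─ B ∣ ≡ ∣ Y ─ B ∣
    closer : suc (dist Y⁺ B) ≡ dist Y B

record Removed (Y B : Subset n) : Set where
  constructor removed
  field
    {Y⁻}   : Subset n
    adj    : dist Y Y⁻ ≡ 1
    size   : suc ∣ Y⁻ ∣ ≡ ∣ Y ∣
    excess : suc ∣ Y⁻ ─ B ∣ ≡ ∣ Y ─ B ∣
    closer : suc (dist Y⁻ B) ≡ dist Y B

add-element : ∀ {j} (Y B : Subset n) → ∣ B ─ Y ∣ ≡ suc j → Added Y B
add-element []          []          ()
add-element (false ∷ Y) (true  ∷ B) p = added {Y⁺ = true ∷ Y} (cong suc (∣A△A∣≡0 Y)) refl refl refl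
add-element (false ∷ Y) (false ∷ B) p with added {Z} a s e c ← add-element Y B p =
  added {Y⁺ = false ∷ Z} a s e c
add-element (true  ∷ Y) (true  ∷ B) p with added {Z} a s e c ← add-element Y B p =
  added {Y⁺ = true ∷ Z} a (cong suc s) e c
add-element (true  ∷ Y) (false ∷ B) p with added {Z} a s e c ← add-element Y B p =
  added {Y⁺ = true ∷ Z} a (cong suc s) (cong suc e) (cong suc c)

remove-element : ∀ {j} (Y B : Subset n) → ∣ Y ─ B ∣ ≡ suc j → Removed Y B
remove-element []          []          ()
remove-element (true  ∷ Y) (false ∷ B) p =
  removed {Y⁻ = false ∷ Y} (cong suc (∣A△A∣≡0 Y)) refl refl refl
remove-element (false ∷ Y) (false ∷ B) p with removed {Z} a s e c ← remove-element Y B p =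
  removed {Y⁻ = false ∷ Z} a s e c
remove-element (true  ∷ Y) (true  ∷ B) p with removed {Z} a s e c ← remove-element Y B p =
  removed {Y⁻ = true ∷ Z} a (cong suc s) e c
remove-element (false ∷ Y) (true  ∷ B) p with removed {Z} a s e c ← remove-element Y B p =
  removed {Y⁻ = false ∷ Z} a s e (cong suc c)

adj-dist : (Y Y′ B : Subset n) → dist Y Y′ ≡ 1 → suc (dist Y′ B) ≡ dist Y B →
           dist Y Y′ + dist Y′ B ≡ dist Y B
adj-dist Y Y′ B a c = trans (cong (_+ dist Y′ B) a) c

≼⇒dist≡ : ∀ k {C B : Subset n} → C ≼ B → ∣ B ∣ ≡ k + ∣ C ∣ → dist C B ≡ k
≼⇒dist≡ k {C} C≼B p = +-cancelˡ-≡ ∣ C ∣ _ _ (trans (≼⇒∣∣+dist C≼B) (trans p (+-comm k ∣ C ∣)))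

-- The elements of `B ─ C` are added one at a time in any order, since `P` is granted for all sets
-- of the sizes strictly in between.
ascend : ∀ {P : Subset n → Set} k {C B : Subset n} → C ≼ B → ∣ B ∣ ≡ k + ∣ C ∣ →
         (∀ X → ∣ C ∣ < ∣ X ∣ → ∣ X ∣ < ∣ B ∣ → P X) → Geodesic P C B
ascend {P = P} zero {C} {B} C≼B p between = subst (Geodesic P C) (dist≡0⇒≡ C B (≼⇒dist≡ 0 C≼B p)) stop
ascend (suc zero) C≼B p between = edge (≼⇒dist≡ 1 C≼B p)
ascend (suc (suc k)) {C} {B} C≼B p between =
  via Y⁺ (between Y⁺ (≤-reflexive (sym size)) (≤-trans (≤-reflexive (cong suc size))
            (≤-trans (s≤s (s≤s (m≤n+m ∣ C ∣ k))) (≤-reflexive (sym p)))))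
      (adj-dist C Y⁺ B adj closer) (edge adj)
      (ascend (suc k) (∣─∣≡0⇒≼ Y⁺ B (trans excess (≼⇒∣─∣≡0 C≼B)))
        (trans p (trans (sym (+-suc (suc k) ∣ C ∣)) (cong (suc k +_) (sym size))))
        (λ X lt → between X (<-trans (≤-reflexive (sym size)) lt)))
  where
  open Added (add-element C B (trans (sym (cong (_+ ∣ B ─ C ∣) (≼⇒∣─∣≡0 C≼B)))
                (trans (sym (dist-split C B)) (≼⇒dist≡ (suc (suc k)) C≼B p))))

-- `P` stands for the complement of a colour class whose sizes are all congruent to `r` modulo
-- `suc t`. Sizes above `r` of another residue are free by `off-level`; `crossing` gives a way
-- through the sizes that do have this residue.
module _ {n} {P : Subset n → Set} {r t : ℕ} (1<t : 1 < t)
  (off-level : ∀ X j q → j < t → ∣ X ∣ ≡ r + suc j + q * suc t → P X)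
  (crossing : ∀ C B → C ≼ B → t * 2 + ∣ C ∣ ≤ ∣ B ∣ →
              ∃[ X ] C ≼ X × X ≼ B × ∣ X ∣ ≡ t + ∣ C ∣ × P X)
  where

  above-level : ∀ {q} {C : Subset n} → ∣ C ∣ ≡ r + 1 + q * suc t →
                ∀ X → ∣ C ∣ < ∣ X ∣ → ∣ X ∣ < t + ∣ C ∣ → P X
  above-level {q} {C} ∣C∣ X lo hi = off-level X j q j<t (begin
      ∣ X ∣                        ≡⟨ m∸n+n≡m (<⇒≤ lo) ⟨
      j + ∣ C ∣                    ≡⟨ cong (j +_) ∣C∣ ⟩
      j + (r + 1 + q * suc t)      ≡⟨ rearrange j r (q * suc t) ⟩
      r + suc j + q * suc t        ∎)
    where
    open ≡-Reasoning
    j = ∣ X ∣ ∸ ∣ C ∣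
    j<t : j < t
    j<t = +-cancelʳ-< ∣ C ∣ j t (≤-<-trans (≤-reflexive (m∸n+n≡m (<⇒≤ lo))) hi)
    rearrange : ∀ j r x → j + (r + 1 + x) ≡ r + suc j + x
    rearrange = solve-∀

  private
    room : ∀ t c x → t * 2 + c + (1 + x) ≡ t + c + (suc t + x)
    room = solve-∀

  open ≡-Reasoning

  -- `C` lies one step above a critical level, and `k` critical levels lie strictly between `C` and
  -- `B`. Each is met in the set `X` given by `crossing`, and one more element restores the
  -- situation for `k - 1`.
  climb : ∀ k q (C B : Subset n) → C ≼ B → ∣ C ∣ ≡ r + 1 + q * suc t →
          ∣ B ∣ ≡ t + ∣ C ∣ + k * suc t → Geodesic P C B
  climb zero q C B C≼B ∣C∣ ∣B∣ =
    ascend t C≼B ∣B∣′ λ X lo hi → above-level {q} {C} ∣C∣ X lo (<-≤-trans hi (≤-reflexive ∣B∣′))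
    where
    ∣B∣′ : ∣ B ∣ ≡ t + ∣ C ∣
    ∣B∣′ = trans ∣B∣ (+-identityʳ _)
  climb (suc k) q C B C≼B ∣C∣ ∣B∣
    -- As another critical level separates `C` from `B`, at least `t + suc t` elements are free,
    -- which exceeds the required `t * 2`.
    with X , C≼X , X≼B , ∣X∣ , PX ← crossing C B C≼B
           (≤-trans (m≤m+n _ (1 + k * suc t)) (≤-reflexive (trans (room t ∣ C ∣ (k * suc t)) (sym ∣B∣))))
    with added {Y} a s e c ← add-element X B (+-cancelˡ-≡ ∣ X ∣ _ _ (begin
      ∣ X ∣ + ∣ B ─ X ∣             ≡⟨ size-balance X B ⟩
      ∣ B ∣ + ∣ X ─ B ∣             ≡⟨ cong (∣ B ∣ +_) (≼⇒∣─∣≡0 X≼B) ⟩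
      ∣ B ∣ + 0                     ≡⟨ +-identityʳ _ ⟩
      ∣ B ∣                         ≡⟨ ∣B∣ ⟩
      t + ∣ C ∣ + suc k * suc t     ≡⟨ cong (_+ suc k * suc t) ∣X∣ ⟨
      ∣ X ∣ + suc k * suc t         ∎))
    = via X PX (≼-via-dist C≼X X≼B C≼B)
        (ascend t C≼X ∣X∣ λ Z lo hi → above-level {q} {C} ∣C∣ Z lo (<-≤-trans hi (≤-reflexive ∣X∣)))
        (via Y (off-level Y 0 (suc q) (<-trans z<s 1<t) ∣Y∣)
             (adj-dist X Y B a c) (edge a)
             (climb k (suc q) Y B (∣─∣≡0⇒≼ Y B (trans e (≼⇒∣─∣≡0 X≼B))) ∣Y∣ (begin
                ∣ B ∣                             ≡⟨ ∣B∣ ⟩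
                t + ∣ C ∣ + suc k * suc t         ≡⟨ cong (_+ suc k * suc t) ∣X∣ ⟨
                ∣ X ∣ + suc k * suc t             ≡⟨ split ∣ X ∣ t (k * suc t) ⟩
                t + suc ∣ X ∣ + k * suc t         ≡⟨ cong (λ z → t + z + k * suc t) s ⟨
                t + ∣ Y ∣ + k * suc t             ∎)))
    where
    split : ∀ x t y → x + (suc t + y) ≡ t + suc x + y
    split = solve-∀
    level : ∀ r t x → suc (t + (r + 1 + x)) ≡ r + 1 + (suc t + x)
    level = solve-∀
    ∣Y∣ : ∣ Y ∣ ≡ r + 1 + suc q * suc t
    ∣Y∣ = trans s (trans (cong suc (trans ∣X∣ (cong (t +_) ∣C∣))) (level r t (q * suc t)))

  -- The elements of Y outside B are removed by alternating between the sizes r + 1 and r + 2.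
  zigzag : ∀ a k (Y B : Subset n) → ∣ Y ─ B ∣ ≡ a → ∣ Y ∣ ≡ suc r → ∣ B ∣ ≡ r + k * suc t →
           Geodesic P Y B
  -- Impossible: `Y` of size `suc r` would be contained in `B` of size `r`.
  zigzag zero zero Y B e ∣Y∣ ∣B∣ = contradiction (≤-trans (m≤m+n (suc r) _) (≤-reflexive (begin
      suc r + ∣ B ─ Y ∣    ≡⟨ cong (_+ ∣ B ─ Y ∣) ∣Y∣ ⟨
      ∣ Y ∣ + ∣ B ─ Y ∣    ≡⟨ size-balance Y B ⟩
      ∣ B ∣ + ∣ Y ─ B ∣    ≡⟨ cong₂ _+_ (trans ∣B∣ (+-identityʳ r)) e ⟩
      r + 0                ≡⟨ +-identityʳ r ⟩
      r                    ∎))) 1+n≰n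
  zigzag zero (suc k) Y B e ∣Y∣ ∣B∣ = climb k 0 Y B (∣─∣≡0⇒≼ Y B e) (trans ∣Y∣ (one r))
    (trans ∣B∣ (trans (shift r t (k * suc t)) (cong (λ z → t + z + k * suc t) (sym ∣Y∣))))
    where
    one : ∀ r → suc r ≡ r + 1 + 0
    one = solve-∀
    shift : ∀ r t x → r + (suc t + x) ≡ t + suc r + x
    shift = solve-∀
  zigzag (suc a) k Y B e ∣Y∣ ∣B∣ with ∣ B ─ Y ∣ in eq
  -- Here `B` is contained in `Y`. Since `B` has at least `r` elements and `Y` has `suc r`, exactly
  -- one element remains to be removed.
  ... | zero = edge (trans (dist-split Y B) (trans (cong₂ _+_ e eq) (trans (+-identityʳ _) (cong suc a≡0))))
    where
    shift : ∀ r x a → r + x + suc a ≡ suc r + (x + a)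
    shift = solve-∀
    a≡0 : a ≡ 0
    a≡0 = m+n≡0⇒n≡0 (k * suc t) (sym (+-cancelˡ-≡ (suc r) _ _ (begin
      suc r + 0                    ≡⟨ cong₂ _+_ ∣Y∣ eq ⟨
      ∣ Y ∣ + ∣ B ─ Y ∣            ≡⟨ size-balance Y B ⟩
      ∣ B ∣ + ∣ Y ─ B ∣            ≡⟨ cong₂ _+_ ∣B∣ e ⟩
      r + k * suc t + suc a        ≡⟨ shift r (k * suc t) a ⟩
      suc r + (k * suc t + a)      ∎)))
  ... | suc b
    with added {Y₁} a₁ s₁ e₁ c₁ ← add-element Y B eq
    with removed {Y₂} a₂ s₂ e₂ c₂ ← remove-element Y₁ B (trans e₁ e)
    -- The set `Y₁` has size `r + 2`, which is off the critical levels because `1 < t`.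
    = via Y₁ (off-level Y₁ 1 0 1<t (trans s₁ (trans (cong suc ∣Y∣) (two r)))) (adj-dist Y Y₁ B a₁ c₁) (edge a₁)
     (via Y₂ (off-level Y₂ 0 0 (<-trans z<s 1<t) (trans ∣Y₂∣ (one r))) (adj-dist Y₁ Y₂ B a₂ c₂) (edge a₂)
       (zigzag a k Y₂ B (suc-injective (trans e₂ (trans e₁ e))) ∣Y₂∣ ∣B∣))
    where
    ∣Y₂∣ = suc-injective (trans s₂ (trans s₁ (cong suc ∣Y∣)))
    one : ∀ r → suc r ≡ r + 1 + 0
    one = solve-∀
    two : ∀ r → suc (suc r) ≡ r + 2 + 0
    two = solve-∀

  -- The first step adds an element of `B`, to leave the level of `A` upwards before anything is
  -- removed. If there is no such element, then `∣ A ∣ ≤ ∣ B ∣` forces `A ≡ B`.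
  level-geodesic : ∀ k (A B : Subset n) → ∣ A ∣ ≡ r → ∣ B ∣ ≡ r + k * suc t → Geodesic P A B
  level-geodesic k A B ∣A∣ ∣B∣ with ∣ B ─ A ∣ in eq
  ... | suc b with added {Y} a s e c ← add-element A B eq =
    via Y (off-level Y 0 0 (<-trans z<s 1<t) (trans s (trans (cong suc ∣A∣) (one r))))
        (adj-dist A Y B a c) (edge a) (zigzag ∣ Y ─ B ∣ k Y B refl (trans s (cong suc ∣A∣)) ∣B∣)
    where
    one : ∀ r → suc r ≡ r + 1 + 0
    one = solve-∀
  ... | zero =
    subst (Geodesic P A) (dist≡0⇒≡ A B (trans (dist-split A B) (cong₂ _+_ excess≡0 eq))) stop
    where
    excess≡0 : ∣ A ─ B ∣ ≡ 0
    excess≡0 = m+n≡0⇒n≡0 (k * suc t) (sym (+-cancelˡ-≡ r _ _ (begin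
      r + 0                            ≡⟨ cong₂ _+_ ∣A∣ eq ⟨
      ∣ A ∣ + ∣ B ─ A ∣                ≡⟨ size-balance A B ⟩
      ∣ B ∣ + ∣ A ─ B ∣                ≡⟨ cong (_+ ∣ A ─ B ∣) ∣B∣ ⟩
      r + k * suc t + ∣ A ─ B ∣        ≡⟨ +-assoc r _ _ ⟩
      r + (k * suc t + ∣ A ─ B ∣)      ∎)))

-- Coordinate selections and linear codes

-- Order-preserving injections of [ k ] into [ n ], given by their image.
data Selection : ℕ → ℕ → Set where
  []   : Selection 0 0
  take : Selection k n → Selection (suc k) (suc n)
  skip : Selection k n → Selection k (suc n)

embed : Selection k n → Subset k → Subset n
embed []       []      = []
embed (take e) (b ∷ X) = b ∷ embed e X
embed (skip e) X       = false ∷ embed e X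

pick : {A : Set} → Selection k n → Vec A n → Vec A k
pick []       []      = []
pick (take e) (v ∷ V) = v ∷ pick e V
pick (skip e) (v ∷ V) = pick e V

∣embed∣ : (e : Selection k n) (X : Subset k) → ∣ embed e X ∣ ≡ ∣ X ∣
∣embed∣ []       []          = refl
∣embed∣ (take e) (false ∷ X) = ∣embed∣ e X
∣embed∣ (take e) (true ∷ X)  = cong suc (∣embed∣ e X)
∣embed∣ (skip e) X           = ∣embed∣ e X

∅ : Subset n
∅ = replicate _ false

∣X∣≡0⇒X≡∅ : (X : Subset n) → ∣ X ∣ ≡ 0 → X ≡ ∅
∣X∣≡0⇒X≡∅ []          _ = refl
∣X∣≡0⇒X≡∅ (false ∷ X) p = cong (false ∷_) (∣X∣≡0⇒X≡∅ X p)
∣X∣≡0⇒X≡∅ (true ∷ X)  ()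

∣∅∣≡0 : ∀ n → ∣ ∅ {n} ∣ ≡ 0
∣∅∣≡0 zero    = refl
∣∅∣≡0 (suc n) = ∣∅∣≡0 n

embed-∅⁻ : (e : Selection k n) (X : Subset k) → embed e X ≡ ∅ → X ≡ ∅
embed-∅⁻ {n = n} e X p =
  ∣X∣≡0⇒X≡∅ X (trans (sym (∣embed∣ e X)) (trans (cong ∣_∣ p) (∣∅∣≡0 n)))

infixl 6 _⊕_

-- Addition over the field with two elements, used both for sets and for their syndromes.
_⊕_ : Subset n → Subset n → Subset n
_⊕_ = zipWith _xor_

⊕-assoc : (X Y Z : Subset n) → (X ⊕ Y) ⊕ Z ≡ X ⊕ (Y ⊕ Z)
⊕-assoc = Vec.zipWith-assoc Bool.xor-assoc

⊕-comm : (X Y : Subset n) → X ⊕ Y ≡ Y ⊕ X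
⊕-comm = Vec.zipWith-comm Bool.xor-comm

⊕-identityˡ : (X : Subset n) → ∅ ⊕ X ≡ X
⊕-identityˡ = Vec.zipWith-identityˡ Bool.xor-identityˡ

⊕-self : (X : Subset n) → X ⊕ X ≡ ∅
⊕-self []      = refl
⊕-self (b ∷ X) = cong₂ _∷_ (Bool.xor-same b) (⊕-self X)

⊕-cancelˡ : (X Y Z : Subset n) → X ⊕ Y ≡ X ⊕ Z → Y ≡ Z
⊕-cancelˡ X Y Z p = trans (sym (back Y)) (trans (cong (X ⊕_) p) (back Z))
  where
  back : ∀ Y → X ⊕ (X ⊕ Y) ≡ Y
  back Y = trans (sym (⊕-assoc X X Y)) (trans (cong (_⊕ Y) (⊕-self X)) (⊕-identityˡ Y))

⊕≡∅⇒≡ : (X Y : Subset n) → X ⊕ Y ≡ ∅ → X ≡ Y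
⊕≡∅⇒≡ X Y p = ⊕-cancelˡ X X Y (trans (⊕-self X) (sym p))

-- The matrix with columns `V` times the indicator vector of `X`.
syndrome : Vec (Subset m) n → Subset n → Subset m
syndrome []      []          = ∅
syndrome (v ∷ V) (true ∷ X)  = v ⊕ syndrome V X
syndrome (v ∷ V) (false ∷ X) = syndrome V X

syndrome-⊕ : (V : Vec (Subset m) n) (X Y : Subset n) →
             syndrome V (X ⊕ Y) ≡ syndrome V X ⊕ syndrome V Y
syndrome-⊕ []      []          []          = sym (⊕-identityˡ ∅)
syndrome-⊕ (v ∷ V) (false ∷ X) (false ∷ Y) = syndrome-⊕ V X Y
syndrome-⊕ (v ∷ V) (true  ∷ X) (false ∷ Y) =
  trans (cong (v ⊕_) (syndrome-⊕ V X Y)) (sym (⊕-assoc v _ _))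
syndrome-⊕ (v ∷ V) (false ∷ X) (true  ∷ Y) = begin
  v ⊕ syndrome V (X ⊕ Y)               ≡⟨ cong (v ⊕_) (trans (syndrome-⊕ V X Y) (⊕-comm _ _)) ⟩
  v ⊕ (syndrome V Y ⊕ syndrome V X)    ≡⟨ ⊕-assoc v _ _ ⟨
  v ⊕ syndrome V Y ⊕ syndrome V X      ≡⟨ ⊕-comm _ _ ⟩
  syndrome V X ⊕ (v ⊕ syndrome V Y)    ∎
  where open ≡-Reasoning
syndrome-⊕ (v ∷ V) (true  ∷ X) (true  ∷ Y) = begin
  syndrome V (X ⊕ Y)                         ≡⟨ syndrome-⊕ V X Y ⟩
  syndrome V X ⊕ syndrome V Y                ≡⟨ cong (_⊕ syndrome V Y) (⊕-identityˡ _) ⟨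
  ∅ ⊕ syndrome V X ⊕ syndrome V Y            ≡⟨ cong (λ z → z ⊕ syndrome V X ⊕ syndrome V Y) (⊕-self v) ⟨
  v ⊕ v ⊕ syndrome V X ⊕ syndrome V Y        ≡⟨ cong (_⊕ syndrome V Y) (trans (⊕-assoc v v _) (⊕-comm v _)) ⟩
  v ⊕ syndrome V X ⊕ v ⊕ syndrome V Y        ≡⟨ ⊕-assoc _ v _ ⟩
  v ⊕ syndrome V X ⊕ (v ⊕ syndrome V Y)      ∎
  where open ≡-Reasoning

syndrome-embed : (V : Vec (Subset m) n) (e : Selection k n) (Y : Subset k) →
                 syndrome V (embed e Y) ≡ syndrome (pick e V) Y
syndrome-embed []      []       []          = refl
syndrome-embed (v ∷ V) (take e) (true ∷ Y)  = cong (v ⊕_) (syndrome-embed V e Y)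
syndrome-embed (v ∷ V) (take e) (false ∷ Y) = syndrome-embed V e Y
syndrome-embed (v ∷ V) (skip e) Y           = syndrome-embed V e Y

-- V is the parity check matrix of a linear code of minimum distance > d.
Separates : ℕ → Vec (Subset m) n → Set
Separates d V = ∀ Z → ∣ Z ∣ ≤ d → syndrome V Z ≡ ∅ → Z ≡ ∅

-- Shortening a code does not lower its distance: a dependency among the chosen columns is, padded
-- with zeros, one among all columns.
pick-separates : ∀ {d} {V : Vec (Subset m) n} (e : Selection k n) →
                 Separates d V → Separates d (pick e V)
pick-separates {V = V} e sep Z ∣Z∣≤d p =
  embed-∅⁻ e Z (sep (embed e Z) (≤-trans (≤-reflexive (∣embed∣ e Z)) ∣Z∣≤d)
                    (trans (syndrome-embed V e Z) p))

-- Satisfiability by the method of conditional expectations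

-- A disjunction of literals: `just b` in place `i` asks variable `i` to be `b`, and `nothing` means
-- that the variable is absent.
Clause : ℕ → Set
Clause = Vec (Maybe Bool)

-- The number of assignments that falsify the clause.
weight : Clause n → ℕ
weight []            = 1
weight (nothing ∷ c) = 2 * weight c
weight (just _ ∷ c)  = weight c

Satisfies : Vec Bool n → Clause n → Set
Satisfies a c = ∃[ i ] lookup c i ≡ just (lookup a i)

weights : List (Clause n) → ℕ
weights cs = sum (List.map weight cs)

restrict : Bool → List (Clause (suc n)) → List (Clause n)
restrict b     []                       = []
restrict b     ((nothing ∷ c) ∷ cs)     = c ∷ restrict b cs
restrict true  ((just true ∷ c) ∷ cs)   = restrict true cs
restrict true  ((just false ∷ c) ∷ cs)  = c ∷ restrict true cs
restrict false ((just true ∷ c) ∷ cs)   = c ∷ restrict false cs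
restrict false ((just false ∷ c) ∷ cs)  = restrict false cs

-- The falsifying assignments of each clause are sorted by their first bit.
weights-restrict : (cs : List (Clause (suc n))) →
                   weights (restrict true cs) + weights (restrict false cs) ≡ weights cs
weights-restrict []                      = refl
weights-restrict ((nothing ∷ c) ∷ cs)    =
  trans (regroup (weight c) _ _) (cong (2 * weight c +_) (weights-restrict cs))
  where
  regroup : ∀ w x y → (w + x) + (w + y) ≡ 2 * w + (x + y)
  regroup = solve-∀
weights-restrict ((just true ∷ c) ∷ cs)  =
  trans (regroup (weight c) (weights (restrict true cs)) _) (cong (weight c +_) (weights-restrict cs))
  where
  regroup : ∀ w x y → x + (w + y) ≡ w + (x + y)
  regroup = solve-∀
weights-restrict ((just false ∷ c) ∷ cs) =
  trans (+-assoc (weight c) _ _) (cong (weight c +_) (weights-restrict cs))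

satisfies-restrict : ∀ b {a : Vec Bool n} cs →
                     All (Satisfies a) (restrict b cs) → All (Satisfies (b ∷ a)) cs
satisfies-restrict b     []                      _              = []
satisfies-restrict b     ((nothing ∷ c) ∷ cs)    ((i , p) ∷ ps) = (suc i , p) ∷ satisfies-restrict b cs ps
satisfies-restrict true  ((just true ∷ c) ∷ cs)  ps             = (zero , refl) ∷ satisfies-restrict true cs ps
satisfies-restrict true  ((just false ∷ c) ∷ cs) ((i , p) ∷ ps) = (suc i , p) ∷ satisfies-restrict true cs ps
satisfies-restrict false ((just true ∷ c) ∷ cs)  ((i , p) ∷ ps) = (suc i , p) ∷ satisfies-restrict false cs ps
satisfies-restrict false ((just false ∷ c) ∷ cs) ps             = (zero , refl) ∷ satisfies-restrict false cs ps

other-half : ∀ {x y s N} → x + y ≡ s → s < 2 * N → N ≤ x → y < N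
other-half {x} {y} {s} {N} x+y≡s s<2N N≤x = +-cancelˡ-< N y N (begin-strict
  N + y  ≤⟨ +-monoˡ-≤ y N≤x ⟩
  x + y  ≡⟨ x+y≡s ⟩
  s      <⟨ s<2N ⟩
  2 * N  ≡⟨ cong (N +_) (+-identityʳ N) ⟩
  N + N  ∎)
  where open ≤-Reasoning

-- One value of the first variable keeps the total weight below half of the bound. With no variables
-- left the bound is 1, so no empty clause can have survived.
satisfiable : (cs : List (Clause n)) → weights cs < 2 ^ n → ∃[ a ] All (Satisfies a) cs
satisfiable {zero}  []        _        = [] , []
satisfiable {zero}  ([] ∷ cs) (s≤s ())
satisfiable {suc n} cs lt with weights (restrict true cs) <? 2 ^ n
... | yes small with a , sats ← satisfiable (restrict true cs) small =
  true ∷ a , satisfies-restrict true cs sats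
... | no large with a , sats ← satisfiable (restrict false cs) (other-half (weights-restrict cs) lt (≮⇒≥ large)) =
  false ∷ a , satisfies-restrict false cs sats

-- Greedy (Gilbert–Varshamov) construction of the code

-- The clause that only `v` falsifies. With it, `satisfiable` doubles as a search for a vector
-- outside a given list.
differs : Subset m → Clause m
differs = Vec.map (just ∘ not)

weight-differs : (v : Subset m) → weight (differs v) ≡ 1
weight-differs []      = refl
weight-differs (b ∷ v) = weight-differs v

weights-differs : (us : List (Subset m)) → weights (List.map differs us) ≡ List.length us
weights-differs []       = refl
weights-differs (u ∷ us) = cong₂ _+_ (weight-differs u) (weights-differs us)

¬satisfies-differs : (v : Subset m) → ¬ Satisfies v (differs v)
¬satisfies-differs (true ∷ v)  (zero , ())
¬satisfies-differs (false ∷ v) (zero , ())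
¬satisfies-differs (b ∷ v)     (suc i , p) = ¬satisfies-differs v (i , p)

fresh-vector : (us : List (Subset m)) → List.length us < 2 ^ m → ∃[ v ] ¬ (v ∈ˡ us)
fresh-vector {m} us lt
  with v , sats ← satisfiable (List.map differs us) (subst (_< 2 ^ m) (sym (weights-differs us)) lt) =
  v , λ v∈us → ¬satisfies-differs v (All.lookup sats (∈ˡ.∈-map⁺ differs v∈us))

small-syndromes : Vec (Subset m) n → ℕ → List (Subset m)
small-syndromes []      d       = ∅ ∷ []
small-syndromes (v ∷ V) zero    = small-syndromes V zero
small-syndromes (v ∷ V) (suc d) = List.map (v ⊕_) (small-syndromes V d) List.++ small-syndromes V (suc d)

-- The length is the sum of the binomial coefficients `n` over `i` for `i ≤ d`, here bounded through
-- Pascal's rule.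
length-small-syndromes : (V : Vec (Subset m) n) (d : ℕ) →
                         List.length (small-syndromes V d) ≤ suc n ^ d
length-small-syndromes []      d    = ≤-reflexive (sym (^-zeroˡ d))
length-small-syndromes (v ∷ V) zero = length-small-syndromes V zero
length-small-syndromes {n = suc n} (v ∷ V) (suc d) = begin
  List.length (List.map (v ⊕_) (small-syndromes V d) List.++ small-syndromes V (suc d))
    ≡⟨ List.length-++ (List.map (v ⊕_) (small-syndromes V d)) ⟩
  List.length (List.map (v ⊕_) (small-syndromes V d)) + List.length (small-syndromes V (suc d))
    ≡⟨ cong (_+ _) (List.length-map (v ⊕_) (small-syndromes V d)) ⟩
  List.length (small-syndromes V d) + List.length (small-syndromes V (suc d))
    ≤⟨ +-mono-≤ (length-small-syndromes V d) (length-small-syndromes V (suc d)) ⟩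
  suc (suc n) * suc n ^ d
    ≤⟨ *-monoʳ-≤ (suc (suc n)) (^-monoˡ-≤ d (n≤1+n (suc n))) ⟩
  suc (suc n) ^ suc d ∎
  where open ≤-Reasoning

∈-small-syndromes : (V : Vec (Subset m) n) (d : ℕ) (X : Subset n) → ∣ X ∣ ≤ d →
                    syndrome V X ∈ˡ small-syndromes V d
∈-small-syndromes []      d       []          _       = here refl
∈-small-syndromes (v ∷ V) zero    (false ∷ X) le      = ∈-small-syndromes V zero X le
∈-small-syndromes (v ∷ V) zero    (true ∷ X)  ()
∈-small-syndromes (v ∷ V) (suc d) (false ∷ X) le      =
  ∈ˡ.∈-++⁺ʳ (List.map (v ⊕_) (small-syndromes V d)) (∈-small-syndromes V (suc d) X le)
∈-small-syndromes (v ∷ V) (suc d) (true ∷ X)  (s≤s le) =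
  ∈ˡ.∈-++⁺ˡ (∈ˡ.∈-map⁺ (v ⊕_) (∈-small-syndromes V d X le))

-- The columns are chosen one by one. A short dependency that involves the new column `v` would make
-- `v` a sum of few earlier columns, and all such sums were avoided.
separating-matrix : ∀ n d → n ^ d < 2 ^ m → ∃[ V ] Separates {m} {n} d V
separating-matrix zero    d lt = [] , λ { [] _ _ → refl }
separating-matrix {m} (suc n) d lt
  with V , sep ← separating-matrix {m} n d (≤-<-trans (^-monoˡ-≤ d (n≤1+n n)) lt)
  with v , v∉ ← fresh-vector (small-syndromes V d) (≤-<-trans (length-small-syndromes V d) lt) =
  v ∷ V , separates
  where
  separates : Separates d (v ∷ V)
  separates (false ∷ Z) le p = cong (false ∷_) (sep Z le p)
  separates (true ∷ Z)  le p = contradiction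
    (subst (_∈ˡ small-syndromes V d) (sym (⊕≡∅⇒≡ v _ p)) (∈-small-syndromes V d Z (≤-trans (n≤1+n _) le)))
    v∉

-- Two-colouring of uniform hypergraphs

pointClause : Bool → List (Fin n) → Clause n
pointClause c = List.foldr (λ i v → v [ i ]≔ just c) (replicate _ nothing)

weight-update : ∀ {c} (v : Clause n) i → lookup v i ≡ nothing →
                2 * weight (v [ i ]≔ just c) ≡ weight v
weight-update (nothing ∷ v) zero    _ = refl
weight-update (nothing ∷ v) (suc i) p = cong (2 *_) (weight-update v i p)
weight-update (just _ ∷ v)  (suc i) p = weight-update v i p

weight-nothing : ∀ n → weight {n} (replicate n nothing) ≡ 2 ^ n
weight-nothing zero    = refl
weight-nothing (suc n) = cong (2 *_) (weight-nothing n)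

lookup-pointClause : ∀ {c b} (l : List (Fin n)) i → lookup (pointClause c l) i ≡ just b →
                     i ∈ˡ l × b ≡ c
lookup-pointClause [] i p = contradiction (trans (sym (Vec.lookup-replicate i nothing)) p) λ ()
lookup-pointClause {c = c} (j ∷ l) i p with i Fin.≟ j
... | yes refl with refl ← trans (sym (Vec.lookup∘update i (pointClause c l) (just c))) p =
  here refl , refl
... | no i≢j
  with i∈l , eq ← lookup-pointClause l i (trans (sym (Vec.lookup∘update′ i≢j (pointClause c l) (just c))) p) =
  there i∈l , eq

lookup-pointClause-∉ : ∀ c (l : List (Fin n)) i → ¬ (i ∈ˡ l) → lookup (pointClause c l) i ≡ nothing
lookup-pointClause-∉ c l i i∉l with lookup (pointClause c l) i in eq
... | nothing = refl
... | just b  = contradiction (proj₁ (lookup-pointClause l i eq)) i∉l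

-- The clause fails only if all points of `l` get the other colour. As the points are distinct, each
-- of them halves the weight.
weight-pointClause : ∀ c {l : List (Fin n)} → Unique l →
                     2 ^ List.length l * weight (pointClause c l) ≡ 2 ^ n
weight-pointClause {n} c {[]} [] = trans (+-identityʳ _) (weight-nothing n)
weight-pointClause {n} c {i ∷ l} (i∉l ∷ u) = begin
  2 * 2 ^ List.length l * weight (pointClause c l [ i ]≔ just c)
    ≡⟨ regroup (2 ^ List.length l) _ ⟩
  2 ^ List.length l * (2 * weight (pointClause c l [ i ]≔ just c))
    ≡⟨ cong (2 ^ List.length l *_) (weight-update (pointClause c l) i
         (lookup-pointClause-∉ c l i λ i∈l → All.lookup i∉l i∈l refl)) ⟩
  2 ^ List.length l * weight (pointClause c l)
    ≡⟨ weight-pointClause c u ⟩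
  2 ^ n ∎
  where
  open ≡-Reasoning
  regroup : ∀ x y → 2 * x * y ≡ x * (2 * y)
  regroup = solve-∀

weights-pointClauses : ∀ c {l} {Es : List (List (Fin n))} →
  All (λ E → Unique E × List.length E ≡ l) Es →
  2 ^ l * weights (List.map (pointClause c) Es) ≡ List.length Es * 2 ^ n
weights-pointClauses c {l} [] = *-zeroʳ (2 ^ l)
weights-pointClauses c {l} {E ∷ Es} ((u , refl) ∷ us) =
  trans (*-distribˡ-+ (2 ^ l) (weight (pointClause c E)) (weights (List.map (pointClause c) Es)))
        (cong₂ _+_ (weight-pointClause c u) (weights-pointClauses c us))

satisfies-pointClause : ∀ {a : Vec Bool n} {c E} → Satisfies a (pointClause c E) →
                        ∃[ i ] i ∈ˡ E × lookup a i ≡ c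
satisfies-pointClause {E = E} (i , p) with i∈E , eq ← lookup-pointClause E i p = i , i∈E , eq

-- Erdős's bound for property B. Each edge gives two clauses, one per colour, and each clause fails
-- for a fraction `1 / 2 ^ l` of the colourings.
two-colourable : ∀ {l} (Es : List (List (Fin n))) →
  All (λ E → Unique E × List.length E ≡ l) Es → 2 * List.length Es < 2 ^ l →
  ∃[ a ] ∀ {E} → E ∈ˡ Es → ∀ c → ∃[ i ] i ∈ˡ E × lookup a i ≡ c
two-colourable {n} {l} Es uniform few = a , λ where
    E∈Es true  → satisfies-pointClause {a = a}
      (All.lookup (All.++⁻ˡ (clauses true) sats) (∈ˡ.∈-map⁺ (pointClause true) E∈Es))
    E∈Es false → satisfies-pointClause {a = a}
      (All.lookup (All.++⁻ʳ (clauses true) sats) (∈ˡ.∈-map⁺ (pointClause false) E∈Es))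
  where
  open ≤-Reasoning
  clauses : Bool → List (Clause n)
  clauses c = List.map (pointClause c) Es
  total : weights (clauses true List.++ clauses false) ≡ weights (clauses true) + weights (clauses false)
  total = trans (cong sum (List.map-++ weight (clauses true) (clauses false)))
                (sum-++ (List.map weight (clauses true)) (List.map weight (clauses false)))
  small : weights (clauses true List.++ clauses false) < 2 ^ n
  small = *-cancelˡ-< (2 ^ l) _ _ (begin-strict
    2 ^ l * weights (clauses true List.++ clauses false)
      ≡⟨ cong (2 ^ l *_) total ⟩
    2 ^ l * (weights (clauses true) + weights (clauses false))
      ≡⟨ *-distribˡ-+ (2 ^ l) (weights (clauses true)) (weights (clauses false)) ⟩
    2 ^ l * weights (clauses true) + 2 ^ l * weights (clauses false)
      ≡⟨ cong₂ _+_ (weights-pointClauses true uniform) (weights-pointClauses false uniform) ⟩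
    List.length Es * 2 ^ n + List.length Es * 2 ^ n
      ≡⟨ double (List.length Es) (2 ^ n) ⟩
    2 * List.length Es * 2 ^ n
      <⟨ *-monoˡ-< (2 ^ n) {{m^n≢0 2 n}} few ⟩
    2 ^ l * 2 ^ n ∎)
    where
    double : ∀ x y → x * y + x * y ≡ 2 * x * y
    double = solve-∀
  solution = satisfiable (clauses true List.++ clauses false) small
  a    = proj₁ solution
  sats = proj₂ solution

-- A two-colouring of the syndromes

vecs : {A : Set} → List A → ∀ n → List (Vec A n)
vecs xs zero    = [] ∷ []
vecs xs (suc n) = List.cartesianProductWith _∷_ xs (vecs xs n)

length-cartesianProductWith : {A B C : Set} (f : A → B → C) (xs : List A) (ys : List B) →
  List.length (List.cartesianProductWith f xs ys) ≡ List.length xs * List.length ys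
length-cartesianProductWith f []       ys = refl
length-cartesianProductWith f (x ∷ xs) ys =
  trans (List.length-++ (List.map (f x) ys))
        (cong₂ _+_ (List.length-map (f x) ys) (length-cartesianProductWith f xs ys))

length-vecs : {A : Set} (xs : List A) → ∀ n → List.length (vecs xs n) ≡ List.length xs ^ n
length-vecs xs zero    = refl
length-vecs xs (suc n) =
  trans (length-cartesianProductWith _∷_ xs (vecs xs n)) (cong (List.length xs *_) (length-vecs xs n))

∈-vecs : {A : Set} {xs : List A} → (∀ x → x ∈ˡ xs) → (v : Vec A n) → v ∈ˡ vecs xs n
∈-vecs all []      = here refl
∈-vecs all (x ∷ v) = ∈ˡ.∈-cartesianProductWith⁺ _∷_ (all x) (∈-vecs all v)

vecs-unique : {A : Set} {xs : List A} → Unique xs → ∀ n → Unique (vecs xs n)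
vecs-unique u zero    = [] ∷ []
vecs-unique u (suc n) = Unique.cartesianProductWith⁺ _∷_ Vec.∷-injective u (vecs-unique u n)

subsets : ∀ n → List (Subset n)
subsets = vecs (true ∷ false ∷ [])

∈-subsets : (X : Subset n) → X ∈ˡ subsets n
∈-subsets = ∈-vecs λ { true → here refl ; false → there (here refl) }

subsets-unique : ∀ n → Unique (subsets n)
subsets-unique = vecs-unique (((λ ()) ∷ []) ∷ [] ∷ [])

bit : Bool → Fin 2
bit false = zero
bit true  = suc zero

bit-injective : ∀ {x y} → bit x ≡ bit y → x ≡ y
bit-injective {false} {false} _ = refl
bit-injective {true}  {true}  _ = refl

index : Subset n → Fin (2 ^ n)
index []      = zero
index (b ∷ X) = combine (bit b) (index X)

index-injective : (X Y : Subset n) → index X ≡ index Y → X ≡ Y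
index-injective []      []      _ = refl
index-injective (b ∷ X) (c ∷ Y) p
  with q , r ← Fin.combine-injective (bit b) (index X) (bit c) (index Y) p =
  cong₂ _∷_ (bit-injective q) (index-injective X Y r)

-- All transversals lie in one level, and their 2 ^ k syndromes fill an affine subspace.
transversal : Subset k → Subset (k * 2)
transversal []      = []
transversal (b ∷ X) = b ∷ not b ∷ transversal X

∣transversal∣ : (X : Subset k) → ∣ transversal X ∣ ≡ k
∣transversal∣ []          = refl
∣transversal∣ (true ∷ X)  = cong suc (∣transversal∣ X)
∣transversal∣ (false ∷ X) = cong suc (∣transversal∣ X)

transversal-injective : (X Y : Subset k) → transversal X ≡ transversal Y → X ≡ Y
transversal-injective []      []      _ = refl
transversal-injective (b ∷ X) (c ∷ Y) p =
  cong₂ _∷_ (Vec.∷-injectiveˡ p) (transversal-injective X Y (Vec.∷-injectiveʳ (Vec.∷-injectiveʳ p)))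

module _ {m t : ℕ} where

  -- The edge generated by an offset `g`, later the syndrome of `C`, and columns `W`, later those of
  -- `t * 2` elements of `B ─ C`.
  flat : Vec (Subset m) (suc (t * 2)) → List (Fin (2 ^ m))
  flat (g ∷ W) = List.map (λ X → index (g ⊕ syndrome W (transversal X))) (subsets t)

  length-flat : ∀ gW → List.length (flat gW) ≡ 2 ^ t
  length-flat (g ∷ W) = trans (List.length-map _ (subsets t)) (length-vecs _ t)

  -- The sum of two transversals has at most `t * 2` elements, so `W` separates their syndromes.
  flat-unique : ∀ g W → Separates (t * 2) W → Unique (flat (g ∷ W))
  flat-unique g W sep = Unique.map⁺ (λ {X} {Y} → injective X Y) (subsets-unique t)
    where
    injective : ∀ X Y → index (g ⊕ syndrome W (transversal X)) ≡ index (g ⊕ syndrome W (transversal Y)) →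
                X ≡ Y
    injective X Y p = transversal-injective X Y (⊕≡∅⇒≡ _ _ (sep _ (∣p∣≤n (transversal X ⊕ transversal Y)) (begin
      syndrome W (transversal X ⊕ transversal Y)
        ≡⟨ syndrome-⊕ W (transversal X) (transversal Y) ⟩
      syndrome W (transversal X) ⊕ syndrome W (transversal Y)
        ≡⟨ cong (_⊕ syndrome W (transversal Y)) (⊕-cancelˡ g _ _ (index-injective _ _ p)) ⟩
      syndrome W (transversal Y) ⊕ syndrome W (transversal Y)
        ≡⟨ ⊕-self _ ⟩
      ∅ ∎)))
      where open ≡-Reasoning

  -- Counting generators instead of sets bounds the number of edges. The filter discards degenerate
  -- flats, to leave a uniform hypergraph.
  flats : List (List (Fin (2 ^ m)))
  flats = List.filter (unique? Fin._≟_) (List.map flat (vecs (subsets m) (suc (t * 2))))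

  length-flats : List.length flats ≤ (2 ^ m) ^ suc (t * 2)
  length-flats = begin
    List.length flats
      ≤⟨ List.length-filter (unique? Fin._≟_) (List.map flat (vecs (subsets m) (suc (t * 2)))) ⟩
    List.length (List.map flat (vecs (subsets m) (suc (t * 2))))
      ≡⟨ List.length-map flat (vecs (subsets m) (suc (t * 2))) ⟩
    List.length (vecs (subsets m) (suc (t * 2)))
      ≡⟨ length-vecs (subsets m) (suc (t * 2)) ⟩
    List.length (subsets m) ^ suc (t * 2)
      ≡⟨ cong (_^ suc (t * 2)) (length-vecs _ m) ⟩
    (2 ^ m) ^ suc (t * 2) ∎
    where open ≤-Reasoning

  flats-uniform : All (λ E → Unique E × List.length E ≡ 2 ^ t) flats
  flats-uniform = All.tabulate λ {E} E∈ →
    let E∈map , u = ∈ˡ.∈-filter⁻ (unique? Fin._≟_) {xs = List.map flat (vecs (subsets m) (suc (t * 2)))} E∈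
        gW , _ , E≡ = ∈ˡ.∈-map⁻ flat E∈map
    in u , trans (cong List.length E≡) (length-flat gW)

  -- Otherwise with-abstractions over the result unfold the greedy searches.
  abstract
    disperser : 2 * (2 ^ m) ^ suc (t * 2) < 2 ^ (2 ^ t) →
      Σ[ φ ∈ (Subset m → Bool) ] ∀ (g : Subset m) (W : Vec (Subset m) (t * 2)) → Separates (t * 2) W →
             ∀ (c : Bool) → Σ[ X ∈ Subset t ] φ (g ⊕ syndrome W (transversal X)) ≡ c
    disperser lt
      with a , hits ← two-colourable flats flats-uniform (≤-<-trans (*-monoʳ-≤ 2 length-flats) lt) =
      lookup a ∘ index {m} , hit
      where
      hit : ∀ (g : Subset m) (W : Vec (Subset m) (t * 2)) → Separates (t * 2) W → ∀ c →
            Σ[ X ∈ Subset t ] lookup a (index (g ⊕ syndrome W (transversal X))) ≡ c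
      hit g W sep c
        with i , i∈ , ai≡c ← hits (∈ˡ.∈-filter⁺ (unique? Fin._≟_)
                                    (∈ˡ.∈-map⁺ flat (∈-vecs ∈-subsets (g ∷ W))) (flat-unique g W sep)) c
        with X , _ , i≡ ← ∈ˡ.∈-map⁻ _ i∈ = X , trans (cong (lookup a) (sym i≡)) ai≡c

-- Colouring the cube by levels and syndromes

select-free : {C B : Subset n} → C ≼ B → ∀ k → k + ∣ C ∣ ≤ ∣ B ∣ →
  ∃[ e ] ∀ (Y : Subset k) → C ≼ C ⊕ embed e Y × C ⊕ embed e Y ≼ B × ∣ C ⊕ embed e Y ∣ ≡ ∣ Y ∣ + ∣ C ∣
select-free [] zero _ = [] , λ { [] → [] , [] , refl }
select-free {C = true ∷ C} (keep true C≼B) k le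
  with e , good ← select-free C≼B k (s≤s⁻¹ (≤-trans (≤-reflexive (sym (+-suc k ∣ C ∣))) le)) =
  skip e , λ Y → let lo , hi , size = good Y in
    keep true lo , keep true hi , trans (cong suc size) (sym (+-suc ∣ Y ∣ ∣ C ∣))
select-free (keep false C≼B) k le with e , good ← select-free C≼B k le =
  skip e , λ Y → let lo , hi , size = good Y in keep false lo , keep false hi , size
select-free {C = false ∷ C} (add C≼B) zero le
  with e , good ← select-free C≼B zero (≤-trans (m≤m+n ∣ C ∣ _) (≤-reflexive (≼⇒∣∣+dist C≼B))) =
  skip e , λ Y → let lo , hi , size = good Y in keep false lo , add hi , size
select-free (add C≼B) (suc k) le with e , good ← select-free C≼B k (s≤s⁻¹ le) = take e , λ where
  (true ∷ Y)  → let lo , hi , size = good Y in add lo , keep true hi , cong suc size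
  (false ∷ Y) → let lo , hi , size = good Y in keep false lo , add hi , size

-- The selected elements lie in `B ─ C`, so `_⊕_` adds them to `C` as a disjoint union. By linearity
-- the syndromes of the sets obtained from transversals form a flat, on which `φ` takes both values.
splitting-colouring : ∀ m n t → n ^ (t * 2) < 2 ^ m → 2 * (2 ^ m) ^ suc (t * 2) < 2 ^ (2 ^ t) →
  Σ[ φ ∈ (Subset n → Bool) ] ∀ (c : Bool) (C B : Subset n) → C ≼ B → t * 2 + ∣ C ∣ ≤ ∣ B ∣ →
         ∃[ X ] C ≼ X × X ≼ B × ∣ X ∣ ≡ t + ∣ C ∣ × φ X ≡ c
splitting-colouring m n t code few
  with V , sep ← separating-matrix {m} n (t * 2) code | φ , hits ← disperser {m} {t} few =
  φ ∘ syndrome V , split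
  where
  split : ∀ c (C B : Subset n) → C ≼ B → t * 2 + ∣ C ∣ ≤ ∣ B ∣ →
          ∃[ X ] C ≼ X × X ≼ B × ∣ X ∣ ≡ t + ∣ C ∣ × φ (syndrome V X) ≡ c
  split c C B C≼B room
    with e , good ← select-free C≼B (t * 2) room
    with X , φ≡c ← hits (syndrome V C) (pick e V) (pick-separates {V = V} e sep) c
    with lo , hi , size ← good (transversal X) =
    C ⊕ embed e (transversal X) , lo , hi , trans size (cong (_+ ∣ C ∣) (∣transversal∣ X)) ,
    trans (cong φ (trans (syndrome-⊕ V C (embed e (transversal X)))
                         (cong (syndrome V C ⊕_) (syndrome-embed V e (transversal X))))) φ≡c

≡-mod : ∀ {a b} t .{{_ : NonZero t}} → a ≤ b → a % t ≡ b % t → ∃[ k ] b ≡ a + k * t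
≡-mod {a} {b} t a≤b eq = b / t ∸ a / t , (begin
  b                                          ≡⟨ m≡m%n+[m/n]*n b t ⟩
  b % t + b / t * t                          ≡⟨ cong₂ (λ x y → x + y * t) (sym eq) (sym (m+[n∸m]≡n (/-monoˡ-≤ t a≤b))) ⟩
  a % t + (a / t + (b / t ∸ a / t)) * t      ≡⟨ cong (a % t +_) (*-distribʳ-+ t (a / t) _) ⟩
  a % t + (a / t * t + (b / t ∸ a / t) * t)  ≡⟨ +-assoc (a % t) _ _ ⟨
  a % t + a / t * t + (b / t ∸ a / t) * t    ≡⟨ cong (_+ (b / t ∸ a / t) * t) (m≡m%n+[m/n]*n a t) ⟨
  a + (b / t ∸ a / t) * t                    ∎)
  where open ≡-Reasoning

-- The class of `A` is avoided by taking `r = ∣ A ∣` and by crossing the levels of the same residue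
-- at sets with the value `not (φ A)`.
level-colouring : ∀ t → 1 < t → (φ : Subset n → Bool) →
  (∀ (c : Bool) (C B : Subset n) → C ≼ B → t * 2 + ∣ C ∣ ≤ ∣ B ∣ →
     ∃[ X ] C ≼ X × X ≼ B × ∣ X ∣ ≡ t + ∣ C ∣ × φ X ≡ c) →
  MutualVisibilityColorable (Q n) (suc t * 2)
level-colouring {n} t 1<t φ splits = colour , visible
  where
  residue : Subset n → Fin (suc t)
  residue X = fromℕ< (m%n<n ∣ X ∣ (suc t))
  colour : Subset n → Fin (suc t * 2)
  colour X = combine (residue X) (bit (φ X))
  same-level : ∀ X Y → colour X ≡ colour Y → ∣ X ∣ % suc t ≡ ∣ Y ∣ % suc t
  same-level X Y p = Fin.fromℕ<-injective _ _ _ _ (proj₁ (Fin.combine-injective (residue X) (bit (φ X)) _ _ p))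
  same-φ : ∀ X Y → colour X ≡ colour Y → φ X ≡ φ Y
  same-φ X Y p = bit-injective (proj₂ (Fin.combine-injective (residue X) (bit (φ X)) (residue Y) _ p))

  module _ (i : Fin (suc t * 2)) where
    upward : ∀ A B → colour A ≡ i → colour B ≡ i → ∣ A ∣ ≤ ∣ B ∣ → Geodesic (λ X → ¬ (colour X ≡ i)) A B
    upward A B A∈ B∈ a≤b =
      level-geodesic 1<t off-level crossing (proj₁ gap) A B refl (proj₂ gap)
      where
      gap = ≡-mod (suc t) a≤b (same-level A B (trans A∈ (sym B∈)))
      off-level : ∀ X j q → j < t → ∣ X ∣ ≡ ∣ A ∣ + suc j + q * suc t → ¬ (colour X ≡ i)
      -- If `X` had the colour of `A`, then `suc t` would divide `suc j`, which is positive and at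
      -- most `t`.
      off-level X j q j<t ∣X∣ X∈ = contradiction (∣⇒≤ (∣m+n∣m⇒∣n T∣ (n∣m*n q))) (<⇒≱ (s≤s j<t))
        where
        gap′ = ≡-mod (suc t)
          (≤-trans (m≤m+n ∣ A ∣ (suc j)) (≤-trans (m≤m+n _ (q * suc t)) (≤-reflexive (sym ∣X∣))))
          (same-level A X (trans A∈ (sym X∈)))
        T∣ : suc t ∣ q * suc t + suc j
        T∣ = subst (suc t ∣_) (+-cancelˡ-≡ ∣ A ∣ _ _ (trans (sym (proj₂ gap′)) (trans ∣X∣
               (trans (+-assoc ∣ A ∣ _ _) (cong (∣ A ∣ +_) (+-comm (suc j) _)))))) (n∣m*n (proj₁ gap′))
      crossing : ∀ C D → C ≼ D → t * 2 + ∣ C ∣ ≤ ∣ D ∣ →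
                 ∃[ X ] C ≼ X × X ≼ D × ∣ X ∣ ≡ t + ∣ C ∣ × ¬ (colour X ≡ i)
      crossing C D C≼D room with X , lo , hi , size , φX ← splits (not (φ A)) C D C≼D room =
        X , lo , hi , size , λ X∈ → Bool.not-¬ (same-φ X A (trans X∈ (sym A∈))) φX

  visible : ∀ i → IsMutualVisibilitySet (Q n) (λ X → colour X ≡ i)
  visible i A B A∈ B∈ with ≤-total ∣ A ∣ ∣ B ∣
  ... | inj₁ a≤b = Geodesic⇒Visible (λ _ X∉ → X∉) (upward i A B A∈ B∈ a≤b)
  ... | inj₂ b≤a = Geodesic⇒Visible (λ _ X∉ → X∉) (reverse (upward i B A B∈ A∈ b≤a))

-- Hypergraph Ramsey theorem

compose : Selection m n → Selection k m → Selection k n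
compose []       []       = []
compose (take e) (take f) = take (compose e f)
compose (take e) (skip f) = skip (compose e f)
compose (skip e) f        = skip (compose e f)

embed-compose : (e : Selection m n) (f : Selection k m) (X : Subset k) →
                embed (compose e f) X ≡ embed e (embed f X)
embed-compose []       []       []      = refl
embed-compose (take e) (take f) (b ∷ X) = cong (b ∷_) (embed-compose e f X)
embed-compose (take e) (skip f) X       = cong (false ∷_) (embed-compose e f X)
embed-compose (skip e) f        X       = cong (false ∷_) (embed-compose e f X)

pick-compose : {A : Set} (e : Selection m n) (f : Selection k m) (v : Vec A n) →
               pick (compose e f) v ≡ pick f (pick e v)
pick-compose []       []       []      = refl
pick-compose (take e) (take f) (x ∷ v) = cong (x ∷_) (pick-compose e f v)
pick-compose (take e) (skip f) (x ∷ v) = pick-compose e f v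
pick-compose (skip e) f        (x ∷ v) = pick-compose e f v

pick-map : {A B : Set} (h : A → B) (e : Selection k n) (v : Vec A n) →
           pick e (Vec.map h v) ≡ Vec.map h (pick e v)
pick-map h []       []      = refl
pick-map h (take e) (x ∷ v) = cong (h x ∷_) (pick-map h e v)
pick-map h (skip e) (x ∷ v) = pick-map h e v

initial : m ≤ n → Selection m n
initial {n = zero}  z≤n       = []
initial {n = suc n} z≤n       = skip (initial z≤n)
initial             (s≤s m≤n) = take (initial m≤n)

pick-none : {A : Set} (e : Selection 0 n) (v : Vec A n) → pick e v ≡ []
pick-none e v with [] ← pick e v = refl

-- Pigeonhole for colour zero against all others. The second outcome is written with `Vec.map suc`,
-- so that `w` uses one colour fewer.
split-sequence : ∀ {q} a b (v : Vec (Fin (suc q)) n) → a + b ≤ n →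
  (∃[ e ] pick {k = a} e v ≡ replicate a zero) ⊎
  (∃[ e ] ∃[ w ] pick {k = b} e v ≡ Vec.map suc w)
split-sequence zero    b       v           _  = inj₁ (initial z≤n , pick-none (initial z≤n) v)
split-sequence (suc a) zero    v           _  = inj₂ (initial z≤n , [] , pick-none (initial z≤n) v)
split-sequence (suc a) (suc b) (zero ∷ v)  le with split-sequence a (suc b) v (s≤s⁻¹ le)
... | inj₁ (e , p)     = inj₁ (take e , cong (zero ∷_) p)
... | inj₂ (e , w , p) = inj₂ (skip e , w , p)
split-sequence (suc a) (suc b) (suc x ∷ v) le
  with split-sequence (suc a) b v (≤-trans (≤-reflexive (sym (+-suc a b))) (s≤s⁻¹ le))
... | inj₁ (e , p)     = inj₁ (skip e , p)
... | inj₂ (e , w , p) = inj₂ (take e , x ∷ w , cong (suc x ∷_) p)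

constant-subsequence : ∀ q m →
  ∃[ N ] ∀ (v : Vec (Fin q) N) → ∃[ e ] ∃[ c ] pick {k = m} e v ≡ replicate m c
-- Length 1 makes the claim vacuous; the empty sequence would still call for a colour in `Fin 0`.
constant-subsequence zero    m = 1 , λ { (() ∷ _) }
constant-subsequence (suc q) m with N , const ← constant-subsequence q m = m + N , found
  where
  found : ∀ v → ∃[ e ] ∃[ c ] pick {k = m} e v ≡ replicate m c
  found v with split-sequence m N v ≤-refl
  ... | inj₁ (e , p) = e , zero , p
  ... | inj₂ (e , w , p) with f , c , q ← const w =
    compose e f , suc c , (begin
      pick (compose e f) v         ≡⟨ pick-compose e f v ⟩
      pick f (pick e v)            ≡⟨ cong (pick f) p ⟩
      pick f (Vec.map suc w)       ≡⟨ pick-map suc f w ⟩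
      Vec.map suc (pick f w)       ≡⟨ cong (Vec.map suc) q ⟩
      Vec.map suc (replicate m c)  ≡⟨ Vec.map-replicate suc c m ⟩
      replicate m (suc c)          ∎)
    where open ≡-Reasoning

-- The entry at the least element of `X`; the default is returned only for the empty set.
first : {A : Set} → A → Vec A n → Subset n → A
first d []      []          = d
first d (x ∷ v) (true ∷ X)  = x
first d (x ∷ v) (false ∷ X) = first d v X

first-embed : {A : Set} (d : A) (e : Selection k n) (v : Vec A n) (X : Subset k) →
              first d v (embed e X) ≡ first d (pick e v) X
first-embed d []       []      []          = refl
first-embed d (take e) (x ∷ v) (true ∷ X)  = refl
first-embed d (take e) (x ∷ v) (false ∷ X) = first-embed d e v X
first-embed d (skip e) (x ∷ v) X           = first-embed d e v X

first-replicate : {A : Set} (d : A) (X : Subset n) → first d (replicate n d) X ≡ d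
first-replicate d []          = refl
first-replicate d (true ∷ X)  = refl
first-replicate d (false ∷ X) = first-replicate d X

Homogeneous : ∀ {q} → ℕ → (Subset n → Fin q) → Set
Homogeneous r f = ∃[ c ] ∀ X → ∣ X ∣ ≡ r → f X ≡ c

Ramsey : ℕ → ℕ → Set
Ramsey q r = ∀ m → ∃[ N ] ∀ (f : Subset N → Fin q) →
             Σ[ e ∈ Selection m N ] Homogeneous r (f ∘ embed e)

-- The Erdős-Rado step: the colour of a set is made to depend on its least element only. The first
-- element is kept, the others are thinned out until the sets completing it all get one colour, and
-- the construction goes on among those left.
min-homogeneous : ∀ {q r} → Ramsey q r → ∀ m →
  ∃[ N ] ∀ (f : Subset N → Fin q) → Σ[ e ∈ Selection m N ] Σ[ g ∈ Vec (Fin q) m ]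
    ∀ d X → ∣ X ∣ ≡ suc r → f (embed e X) ≡ first d g X
min-homogeneous         ramsey zero    = 0 , λ f → [] , [] , λ { d [] () }
min-homogeneous {q} {r} ramsey (suc m)
  with M , homM ← min-homogeneous ramsey m
  with N , homN ← ramsey M = suc N , found
  where
  found : ∀ (f : Subset (suc N) → Fin q) → Σ[ e ∈ Selection (suc m) (suc N) ] Σ[ g ∈ Vec (Fin q) (suc m) ]
            ∀ d X → ∣ X ∣ ≡ suc r → f (embed e X) ≡ first d g X
  found f with e , c , hom-e ← homN (f ∘ (true ∷_))
          with h , g , hom-h ← homM (f ∘ (false ∷_) ∘ embed e) =
    take (compose e h) , c ∷ g , λ where
      d (true ∷ X)  p → trans (cong (f ∘ (true ∷_)) (embed-compose e h X))
                              (hom-e (embed h X) (trans (∣embed∣ h X) (suc-injective p)))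
      d (false ∷ X) p → trans (cong (f ∘ (false ∷_)) (embed-compose e h X)) (hom-h d X p)

ramsey : ∀ q r → Ramsey q r
ramsey q zero    m = m , λ f → let e = initial ≤-refl in
  e , f (embed e ∅) , λ X p → cong (f ∘ embed e) (∣X∣≡0⇒X≡∅ X p)
ramsey q (suc r) m
  with M , const ← constant-subsequence q m
  with N , homN ← min-homogeneous (ramsey q r) M = N , λ f →
  let e , g , hom = homN f
      h , c , g≡c = const g
  in compose e h , c , λ X p →
     trans (cong f (embed-compose e h X))
    -- The default for `first` is the constant colour `c` itself, so `first-replicate` needs no case
    -- for the empty set.
    (trans (hom c (embed h X) (trans (∣embed∣ h X) p))
    (trans (first-embed c h g X)
    (trans (cong (λ v → first c v X) g≡c) (first-replicate c X))))

-- The sizes are treated one after another; homogeneity survives the passage to a smaller selection.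
simultaneous-ramsey : ∀ q R m → ∃[ N ] ∀ (f : Subset N → Fin q) →
  Σ[ e ∈ Selection m N ] ∀ r → r < R → Homogeneous r (f ∘ embed e)
simultaneous-ramsey q zero    m = m , λ f → initial ≤-refl , λ { _ () }
simultaneous-ramsey q (suc R) m
  with M , homM ← simultaneous-ramsey q R m
  with N , homN ← ramsey q R M = N , found
  where
  found : ∀ (f : Subset N → Fin q) → Σ[ e ∈ Selection m N ] ∀ r → r < suc R → Homogeneous r (f ∘ embed e)
  found f with e , c , hom-e ← homN f with h , hom-h ← homM (f ∘ embed e) = compose e h , hom
    where
    hom : ∀ r → r < suc R → Homogeneous r (f ∘ embed (compose e h))
    hom r r<sR with r ≟ R
    ... | yes refl = c , λ X p → trans (cong f (embed-compose e h X)) (hom-e (embed h X) (trans (∣embed∣ h X) p))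
    ... | no r≢R with c′ , hom-r ← hom-h r (≤∧≢⇒< (s≤s⁻¹ r<sR) r≢R) =
      c′ , λ X p → trans (cong f (embed-compose e h X)) (hom-r X p)

-- The pigeonhole principle is applied to the values tagged with whether they occurred before.
three-alike : ∀ {q} (h : Fin (suc (q * 2)) → Fin q) →
  ∃[ i ] ∃[ j ] ∃[ k ] i Fin.< j × j Fin.< k × h i ≡ h j × h j ≡ h k
three-alike {q} h = conclude (earlier? i) (earlier? j) refl refl
  where
  earlier? : ∀ j → Dec (∃[ i ] i Fin.< j × h i ≡ h j)
  earlier? j = Fin.any? λ i → (i Fin.<? j) ×-dec (h i Fin.≟ h j)
  repeated = λ j → combine (h j) (bit (Dec.does (earlier? j)))
  pair = Fin.pigeonhole (n<1+n (q * 2)) repeated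
  i = proj₁ pair
  j = proj₁ (proj₂ pair)
  i<j = proj₁ (proj₂ (proj₂ pair))
  same = Fin.combine-injective (h i) (bit (Dec.does (earlier? i))) (h j) (bit (Dec.does (earlier? j)))
           (proj₂ (proj₂ (proj₂ pair)))
  conclude : (di : Dec (∃[ k ] k Fin.< i × h k ≡ h i)) (dj : Dec (∃[ k ] k Fin.< j × h k ≡ h j)) →
             Dec.does di ≡ Dec.does (earlier? i) → Dec.does dj ≡ Dec.does (earlier? j) →
             ∃[ i ] ∃[ j ] ∃[ k ] i Fin.< j × j Fin.< k × h i ≡ h j × h j ≡ h k
  -- An earlier occurrence of `h i` completes a triple. Otherwise the tag of `i` is false and that
  -- of `j` is true, because of `i`, although the tags agree.
  conclude (yes (k , k<i , hk≡hi)) _ _ _ = k , i , j , k<i , i<j , hk≡hi , proj₁ same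
  conclude (no _) (no ¬e) _ _ = contradiction (i , i<j , proj₁ same) ¬e
  conclude (no _) (yes _) p q = contradiction (trans p (trans (bit-injective (proj₂ same)) (sym q))) λ ()

-- The lower bound: three sizes on a chain

prefix : ∀ n → ℕ → Subset n
prefix zero    i       = []
prefix (suc n) zero    = false ∷ prefix n zero
prefix (suc n) (suc i) = true ∷ prefix n i

∣prefix∣ : ∀ {i} → i ≤ n → ∣ prefix n i ∣ ≡ i
∣prefix∣ {zero}  z≤n       = refl
∣prefix∣ {suc n} z≤n       = ∣prefix∣ {n} z≤n
∣prefix∣         (s≤s i≤n) = cong suc (∣prefix∣ i≤n)

prefix-mono : ∀ n {i j} → i ≤ j → prefix n i ≼ prefix n j
prefix-mono zero    _                 = []
prefix-mono (suc n) {j = zero}  z≤n   = keep false (prefix-mono n z≤n)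
prefix-mono (suc n) {j = suc j} z≤n   = add (prefix-mono n z≤n)
prefix-mono (suc n) (s≤s i≤j)         = keep true (prefix-mono n i≤j)

embed-mono : (e : Selection k n) {X Y : Subset k} → X ≼ Y → embed e X ≼ embed e Y
embed-mono []       []         = []
embed-mono (take e) (keep b p) = keep b (embed-mono e p)
embed-mono (take e) (add p)    = add (embed-mono e p)
embed-mono (skip e) p          = keep false (embed-mono e p)

-- The embedded subcube is closed under subsets. Hence the sets on a shortest path between nested
-- embedded sets belong to it, and their colours depend on their sizes only.
≼embed⇒embed : (e : Selection k n) (Y : Subset k) {Z : Subset n} → Z ≼ embed e Y → ∃[ X ] Z ≡ embed e X
≼embed⇒embed []       []      []         = [] , refl
≼embed⇒embed (take e) (b ∷ Y) (keep b p) with X , q ← ≼embed⇒embed e Y p = b ∷ X , cong (b ∷_) q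
≼embed⇒embed (take e) (b ∷ Y) (add p)    with X , q ← ≼embed⇒embed e Y p = false ∷ X , cong (false ∷_) q
≼embed⇒embed (skip e) Y       (keep b p) with X , q ← ≼embed⇒embed e Y p = X , cong (false ∷_) q

not-colourable : ∀ q → ∃[ N ] ∀ n → N ≤ n → ¬ MutualVisibilityColorable (Q n) q
not-colourable q
  -- A base set of `q * 2` elements has subsets of `suc (q * 2)` sizes, as many as `three-alike`
  -- asks for.
  with N , hom ← simultaneous-ramsey q (suc (q * 2)) (q * 2) = N , refute
  where
  refute : ∀ n → N ≤ n → ¬ MutualVisibilityColorable (Q n) q
  refute n N≤n (c , visible) = blocked (three-alike (λ i → proj₁ (levels i)))
    where
    selection = hom (c ∘ embed (initial N≤n))
    e = compose (initial N≤n) (proj₁ selection)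
    levels : ∀ (i : Fin (suc (q * 2))) → Homogeneous (toℕ i) (c ∘ embed e)
    levels i with col , h ← proj₂ selection (toℕ i) (Fin.toℕ<n i) =
      col , λ X p → trans (cong c (embed-compose (initial N≤n) (proj₁ selection) X)) (h X p)
    blocked : ¬ (∃[ i ] ∃[ j ] ∃[ k ] i Fin.< j × j Fin.< k ×
                 proj₁ (levels i) ≡ proj₁ (levels j) × proj₁ (levels j) ≡ proj₁ (levels k))
    blocked (i , j , k , i<j , j<k , ci≡cj , cj≡ck) = hits-M (cX≡cA , λ where
        (inj₁ A≡X) → <⇒≢ i<j (trans (sym (size i)) (trans (cong ∣_∣ A≡X) ∣X∣≡j))
        (inj₂ B≡X) → <⇒≢ j<k (sym (trans (sym (size k)) (trans (cong ∣_∣ B≡X) ∣X∣≡j))))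
      where
      P : Fin (suc (q * 2)) → Subset (q * 2)
      P l = prefix (q * 2) (toℕ l)
      ∣P∣ : ∀ l → ∣ P l ∣ ≡ toℕ l
      ∣P∣ l = ∣prefix∣ (s≤s⁻¹ (Fin.toℕ<n l))
      size : ∀ l → ∣ embed e (P l) ∣ ≡ toℕ l
      size l = trans (∣embed∣ e (P l)) (∣P∣ l)
      A = embed e (P i)
      B = embed e (P k)
      cB≡cA : c B ≡ c A
      cB≡cA = trans (proj₂ (levels k) (P k) (∣P∣ k))
                    (sym (trans (proj₂ (levels i) (P i) (∣P∣ i)) (trans ci≡cj cj≡ck)))
      view = visible (c A) A B refl cB≡cA
      w = proj₁ view
      crossing = crosses-level w (toℕ j) (≤-trans (≤-reflexive (size i)) (<⇒≤ i<j))
                               (≤-trans (<⇒≤ j<k) (≤-reflexive (sym (size k))))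
      X = proj₁ crossing
      ∣X∣≡j = proj₁ (proj₂ crossing)
      hits-M = All.lookup (proj₂ (proj₂ view)) (proj₁ (proj₂ (proj₂ crossing)))
      X≼B : X ≼ B
      X≼B = between⇒≼ X (embed-mono e (prefix-mono (q * 2) (<⇒≤ (<-trans i<j j<k))))
              (≤-trans (proj₂ (proj₂ (proj₂ crossing)))
                       (≤-reflexive (IsShortestPath⇒length≡dist w (proj₁ (proj₂ view)))))
      cX≡cA : c X ≡ c A
      cX≡cA = let X′ , X≡ = ≼embed⇒embed e (P k) X≼B in
        trans (cong c X≡) (trans (proj₂ (levels j) X′
          (trans (sym (∣embed∣ e X′)) (trans (cong ∣_∣ (sym X≡)) ∣X∣≡j)))
          (trans (sym ci≡cj) (sym (proj₂ (levels i) (P i) (∣P∣ i)))))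

-- Decidability of colourability

walk? : {R : Subset n → Set} → Decidable R → ∀ l (A B : Subset n) →
        Dec (∃[ w ] length (Q n) {A} {B} w ≡ l × All R (vertices (Q n) w))
walk? R? zero A B = Dec.map′
  (λ { (refl , r) → ε , refl , r ∷ [] }) (λ { (ε , _ , r ∷ []) → refl , r })
  (Vec.≡-dec Bool._≟_ A B ×-dec R? A)
walk? R? (suc l) A B = Dec.map′
  (λ { (r , C , A~C , w , p , rs) → A~C ◅ w , cong suc p , r ∷ rs })
  (λ { (A~C ◅ w , p , r ∷ rs) → r , _ , A~C , w , suc-injective p , rs })
  (R? A ×-dec anySubset? (λ C → (dist A C ≟ 1) ×-dec walk? R? l C B))

-- Shortest paths are exactly the walks of length `dist A B`, so a finite search decides visibility.
visible? : {M : Pred (Subset n) 0ℓ} → Decidable M → ∀ A B → Dec (Visible (Q n) M A B)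
visible? M? A B = Dec.map′
  (λ (w , l , avoids) → w , length≡dist⇒IsShortestPath w l , avoids)
  (λ (w , shortest , avoids) → w , IsShortestPath⇒length≡dist w shortest , avoids)
  (walk? (λ X → ¬? (M? X ×-dec ¬? ((A ≟ˢ X) ⊎-dec (B ≟ˢ X)))) (dist A B) A B)
  where _≟ˢ_ = Vec.≡-dec Bool._≟_

visible-antitone : {M M′ : Pred (Subset n) 0ℓ} {A B : Subset n} → (∀ X → M′ X → M X) →
                   Visible (Q n) M A B → Visible (Q n) M′ A B
visible-antitone M′⊆M (w , shortest , avoids) =
  w , shortest , All.map (λ X∉ (X∈M′ , X≢) → X∉ (M′⊆M _ X∈M′ , X≢)) avoids

allSubsets? : {P : Subset n → Set} → Decidable P → Dec (∀ X → P X)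
allSubsets? P? = Dec.map′
  (λ ¬∃ X → Dec.decidable-stable (P? X) λ ¬P → ¬∃ (X , ¬P))
  (λ all (X , ¬P) → ¬P (all X))
  (¬? (anySubset? (¬? ∘ P?)))

-- A colouring is assembled from its restrictions to two opposite facets. This recovers it only
-- pointwise, hence the hypothesis that `P` respects pointwise equality.
anyColouring? : ∀ n {k} {P : (Subset n → Fin k) → Set} →
                (∀ {c d} → (∀ X → c X ≡ d X) → P c → P d) → Decidable P → Dec (∃ P)
anyColouring? zero    resp P? = Dec.map′
  (λ (i , p) → (λ _ → i) , p) (λ (c , p) → c [] , resp (λ { [] → refl }) p)
  (Fin.any? λ i → P? λ _ → i)
anyColouring? (suc n) {k} {P} resp P? = Dec.map′
  (λ (c , d , p) → join c d , p)
  (λ (c , p) → c ∘ (true ∷_) , c ∘ (false ∷_) , resp (λ { (true ∷ X) → refl ; (false ∷ X) → refl }) p)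
  (anyColouring? n
    (λ c≗ (d , p) → d , resp (λ { (true ∷ X) → c≗ X ; (false ∷ X) → refl }) p)
    (λ c → anyColouring? n
      (λ d≗ → resp (λ { (true ∷ X) → refl ; (false ∷ X) → d≗ X }))
      (λ d → P? (join c d))))
  where
  join : (Subset n → Fin k) → (Subset n → Fin k) → Subset (suc n) → Fin k
  join c d (true ∷ X)  = c X
  join c d (false ∷ X) = d X

colourable? : ∀ n → Decidable (MutualVisibilityColorable (Q n))
colourable? n k = anyColouring? n
  (λ c≗d visible i A B A∈ B∈ → visible-antitone (λ X X∈ → trans (c≗d X) X∈)
    (visible i A B (trans (c≗d A) A∈) (trans (c≗d B) B∈)))
  (λ c → Fin.all? λ i → allSubsets? λ A → allSubsets? λ B →
    (c A Fin.≟ i) →-dec ((c B Fin.≟ i) →-dec visible? (λ X → c X Fin.≟ i) A B))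

colourable-mono : ∀ {n j k} → j ≤ k →
                  MutualVisibilityColorable (Q n) j → MutualVisibilityColorable (Q n) k
colourable-mono j≤k (c , visible) = (λ X → Fin.inject≤ (c X) j≤k) , λ i A B A∈ B∈ →
  visible-antitone (λ X X∈ → Fin.inject≤-injective j≤k j≤k (c X) (c A) (trans X∈ (sym A∈)))
    (visible (c A) A B refl (Fin.inject≤-injective j≤k j≤k (c B) (c A) (trans B∈ (sym A∈))))

least-below : {P : ℕ → Set} → Decidable P → ∀ k →
              (∃[ l ] P l × (∀ j → P j → l ≤ j)) ⊎ (∀ j → j < k → ¬ P j)
least-below P? zero    = inj₂ λ _ ()
least-below P? (suc k) with least-below P? k
... | inj₁ found = inj₁ found
... | inj₂ none with P? k
...   | yes p = inj₁ (k , p , λ j Pj → ≮⇒≥ λ j<k → none j j<k Pj)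
...   | no ¬p = inj₂ λ j j<sk Pj → none j (≤∧≢⇒< (s≤s⁻¹ j<sk) λ { refl → ¬p Pj }) Pj

least : {P : ℕ → Set} → Decidable P → ∀ k → P k → ∃[ l ] P l × (∀ j → P j → l ≤ j)
least P? k Pk with least-below P? (suc k)
... | inj₁ found = found
... | inj₂ none  = contradiction Pk (none k ≤-refl)

chromatic-number : ∀ {n k} → MutualVisibilityColorable (Q n) k →
                   ∃[ χ ] IsChromaticMutualVisibilityNumber (Q n) χ × χ ≤ k
chromatic-number {n} {k} col with χ , colχ , min ← least (colourable? n) k col =
  χ , (colχ , min) , min k col

-- Estimates for the parameters

n<2^[1+⌊log₂n⌋] : ∀ n → n < 2 ^ suc ⌊log₂ n ⌋
n<2^[1+⌊log₂n⌋] n = ≰⇒> λ 2^≤n → 1+n≰n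
  (subst (_≤ ⌊log₂ n ⌋) (⌊log₂[2^n]⌋≡n (suc ⌊log₂ n ⌋)) (⌊log₂⌋-mono-≤ 2^≤n))

n<2^n : ∀ n → n < 2 ^ n
n<2^n zero    = s≤s z≤n
n<2^n (suc n) = begin-strict
  suc n          ≤⟨ n<2^n n ⟩
  2 ^ n          <⟨ m<m+n (2 ^ n) (m^n>0 2 n) ⟩
  2 ^ n + 2 ^ n  ≡⟨ cong (2 ^ n +_) (+-identityʳ _) ⟨
  2 ^ suc n      ∎
  where open ≤-Reasoning

1+y^15<y^16 : ∀ {y} → 2 ≤ y → 1 + y ^ 15 < y ^ 16
1+y^15<y^16 {y} 2≤y = begin-strict
  1 + y ^ 15       <⟨ +-monoˡ-< (y ^ 15) (≤-trans 2≤y (≤-trans (≤-reflexive (sym (^-identityʳ y)))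
                        (^-monoʳ-≤ y {{>-nonZero (<-trans z<s 2≤y)}} {1} {15} (s≤s z≤n)))) ⟩
  y ^ 15 + y ^ 15  ≡⟨ cong (y ^ 15 +_) (+-identityʳ _) ⟨
  2 * y ^ 15       ≤⟨ *-monoˡ-≤ (y ^ 15) 2≤y ⟩
  y ^ 16           ∎
  where open ≤-Reasoning

-- For y = 2 ^ x, t = 16 x and s = 2t this is the counting condition of disperser in logarithmic
-- form, with m = 1 + y s.
1+[1+y*s]*[1+s]<y^16 : ∀ {y s} → 2 ≤ y → suc s ≤ y ^ 7 → suc (suc (y * s) * suc s) < y ^ 16
1+[1+y*s]*[1+s]<y^16 {y} {s} 2≤y 1+s≤y^7 = begin-strict
  suc (suc (y * s) * suc s)   ≤⟨ s≤s (*-monoˡ-≤ (suc s) (+-monoˡ-≤ (y * s) (<⇒≤ 2≤y))) ⟩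
  suc ((y + y * s) * suc s)   ≡⟨ cong (λ z → suc (z * suc s)) (*-suc y s) ⟨
  suc (y * suc s * suc s)     ≤⟨ s≤s (*-mono-≤ (*-monoʳ-≤ y 1+s≤y^7) 1+s≤y^7) ⟩
  suc (y ^ 8 * y ^ 7)         ≡⟨ cong suc (^-distribˡ-+-* y 8 7) ⟨
  1 + y ^ 15                  <⟨ 1+y^15<y^16 2≤y ⟩
  y ^ 16                      ∎
  where open ≤-Reasoning

1+2t≤y^7 : ∀ {x y} → 0 < x → x ≤ y → 2 ≤ y → suc (x * 16 * 2) ≤ y ^ 7
1+2t≤y^7 {x} {y} 0<x x≤y 2≤y = begin
  suc (x * 16 * 2)     ≤⟨ +-monoˡ-≤ (x * 16 * 2) 0<x ⟩
  x + x * 16 * 2       ≡⟨ collect x ⟩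
  -- The second factor uses `33 ≤ 64 = 2 ^ 6`.
  x * 33               ≤⟨ *-mono-≤ x≤y (≤-trans (m≤m+n 33 31) (^-monoˡ-≤ 6 2≤y)) ⟩
  y * y ^ 6            ∎
  where
  open ≤-Reasoning
  collect : ∀ x → x + x * 16 * 2 ≡ x * 33
  collect = solve-∀

2*[2^m]^s<2^2^t : ∀ m s t → suc (m * s) < 2 ^ t → 2 * (2 ^ m) ^ s < 2 ^ (2 ^ t)
2*[2^m]^s<2^2^t m s t lt =
  subst (_< 2 ^ (2 ^ t)) (cong (2 *_) (sym (^-*-assoc 2 m s))) (^-monoʳ-< 2 (s≤s (s≤s z≤n)) lt)

n^s<2^[1+y*s] : ∀ {n y} s → n ≤ 2 ^ y → n ^ s < 2 ^ suc (y * s)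
n^s<2^[1+y*s] {n} {y} s n≤ = begin-strict
  n ^ s                ≤⟨ ^-monoˡ-≤ s n≤ ⟩
  (2 ^ y) ^ s          ≡⟨ ^-*-assoc 2 y s ⟩
  2 ^ (y * s)          <⟨ ^-monoʳ-< 2 (s≤s (s≤s z≤n)) (n<1+n (y * s)) ⟩
  2 ^ suc (y * s)      ∎
  where open ≤-Reasoning

-- With `y = 2 ^ x` and `t = x * 16`, the code condition holds for `m = suc (y * s)` because
-- `n ≤ 2 ^ y`, and the counting condition because `2 ^ t = y ^ 16`.
colourable-by-levels : ∀ n x → 0 < x → n ≤ 2 ^ (2 ^ x) → MutualVisibilityColorable (Q n) (suc (x * 16) * 2)
colourable-by-levels n x 0<x n≤ =
  level-colouring (x * 16) (≤-trans (s≤s (s≤s z≤n)) (*-monoˡ-≤ 16 0<x)) (proj₁ splitting) (proj₂ splitting)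
  where
  y s : ℕ
  y = 2 ^ x
  s = x * 16 * 2
  2≤y : 2 ≤ y
  2≤y = ≤-trans (s≤s 0<x) (n<2^n x)
  few : suc (suc (y * s) * suc s) < 2 ^ (x * 16)
  few = subst (suc (suc (y * s) * suc s) <_) (^-*-assoc 2 x 16)
          (1+[1+y*s]*[1+s]<y^16 2≤y (1+2t≤y^7 0<x (<⇒≤ (n<2^n x)) 2≤y))
  splitting = splitting-colouring (suc (y * s)) n (x * 16) (n^s<2^[1+y*s] {y = y} s n≤)
                (2*[2^m]^s<2^2^t (suc (y * s)) (suc s) (x * 16) few)

colourable : ∀ n → MutualVisibilityColorable (Q n) (suc (suc ⌊log₂log₂ n ⌋ * 16) * 2)
-- The successor makes up for rounding down in both logarithms and keeps `x` positive.
colourable n = colourable-by-levels n (suc ⌊log₂log₂ n ⌋) z<s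
  (≤-trans (<⇒≤ (n<2^[1+⌊log₂n⌋] n)) (^-monoʳ-≤ 2 (n<2^[1+⌊log₂n⌋] ⌊log₂ n ⌋)))

1≤⌊log₂log₂n⌋ : ∀ n → n ≥ 4 → 1 ≤ ⌊log₂log₂ n ⌋
1≤⌊log₂log₂n⌋ n n≥4 = ⌊log₂⌋-mono-≤ {2} (⌊log₂⌋-mono-≤ {4} n≥4)

colours-bound : ∀ l → 1 ≤ l → suc (suc l * 16) * 2 ≤ 66 * l
colours-bound l 1≤l = begin
  suc (suc l * 16) * 2   ≡⟨ expand l ⟩
  34 + 32 * l            ≤⟨ +-monoˡ-≤ (32 * l) (*-monoʳ-≤ 34 1≤l) ⟩
  34 * l + 32 * l        ≡⟨ *-distribʳ-+ l 34 32 ⟨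
  66 * l                 ∎
  where
  open ≤-Reasoning
  expand : ∀ l → suc (suc l * 16) * 2 ≡ 34 + 32 * l
  expand = solve-∀

-- Both bounds for the chromatic mutual-visibility number

theorem1p5 : (∀ (q : ℕ) → q > 0 →
    ∃[ n₀ ] n₀ > 0 ×
    (∀ (n : ℕ) → n ≥ n₀ →
    ∃[ χ ] IsChromaticMutualVisibilityNumber (Q n) χ × χ > q))
    ×
    (∃[ C ] ∃[ n₁ ] C > 0 ×
    (∀ (n : ℕ) → n ≥ n₁ →
    ∃[ χ ] IsChromaticMutualVisibilityNumber (Q n) χ × χ ≤ C * ⌊log₂log₂ n ⌋))
-- From `n = 4` on the double logarithm is at least 1, which absorbs the constant term of
-- `34 + 32 * l` into `66 * l`.
theorem1p5 = lower , 66 , 4 , z<s , upper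
  where
  upper : ∀ n → n ≥ 4 → ∃[ χ ] IsChromaticMutualVisibilityNumber (Q n) χ × χ ≤ 66 * ⌊log₂log₂ n ⌋
  upper n n≥4 = let χ , isχ , χ≤ = chromatic-number (colourable n) in
    χ , isχ , ≤-trans χ≤ (colours-bound _ (1≤⌊log₂log₂n⌋ n n≥4))
  lower : ∀ q → q > 0 → ∃[ n₀ ] n₀ > 0 × (∀ n → n ≥ n₀ →
          ∃[ χ ] IsChromaticMutualVisibilityNumber (Q n) χ × χ > q)
  lower q _ with N , refute ← not-colourable q = suc N , z<s , bound
    where
    bound : ∀ n → n ≥ suc N → ∃[ χ ] IsChromaticMutualVisibilityNumber (Q n) χ × χ > q
    -- The colouring from the upper bound guarantees that a least number of colours exists.
    bound n n≥ = let χ , isχ , _ = chromatic-number (colourable n) in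
      χ , isχ , ≰⇒> λ χ≤q → refute n (≤-trans (n≤1+n N) n≥) (colourable-mono χ≤q (proj₁ isχ))
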